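{- Let $G$ be a connected graph of order $n$ and let $k$ be an integer such that $3\leq k\leq n$. Then $\kappa_k(G)=n-\lceil\frac{k}{2}\rceil$ if and only if the following holds: $G=K_n$ if $k$ is even; and $G=K_n\setminus M$ for some edge set $M\subseteq E(K_n)$ with $0\leq |M|\leq \frac{k-1}{2}$ if $k$ is odd.
   Context: All graphs are undirected, finite and simple. For a graph $G$ and a set $S\subseteq V(G)$ of at least two vertices, a tree connecting $S$ is a subgraph $T$ of $G$ that is a tree with $S\subseteq V(T)$. Two trees $T,T'$ connecting $S$ are internally disjoint if $E(T)\cap E(T')=\varnothing$ and $V(T)\cap V(T')=S$. Let $\kappa(S)$ be the maximum number of pairwise internally disjoint trees connecting $S$ in $G$. The generalized $k$-connectivity of $G$ is $\kappa_k(G)=\min\{\kappa(S) : S\subseteq V(G),\ |S|=k\}$. $K_n$ is the complete graph of order $n$, and $K_n\setminus M$ is the graph obtained from $K_n$ by deleting the edges of $M$ (keeping all vertices). Equality of graphs is understood up to isomorphism. -}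

module Defs where

open import Data.Bool using (Bool; false; not; _∧_; T)
open import Data.Bool.Properties using (T?)
open import Data.Empty using (⊥)
open import Data.Fin using (Fin; _<?_; _≟_)
open import Data.Fin.Permutation using (Permutation′; _⟨$⟩ʳ_)
open import Data.Fin.Subset using (Subset; _∈_; _⊆_; _∩_; ∣_∣; Nonempty)
open import Data.List using (List; []; _∷_; _++_; length; filter; allFin; cartesianProduct)
open import Data.List.Relation.Unary.Linked using (Linked)
open import Data.List.Relation.Unary.Unique.Propositional using (Unique)
open import Data.Nat using (ℕ; _≤_)
open import Data.Product using (Σ; ∃; _×_; _,_)
open import Relation.Binary.Construct.Closure.ReflexiveTransitive using (Star)
open import Relation.Binary.PropositionalEquality using (_≡_; _≢_; refl; sym; cong; cong₂)
open import Relation.Nullary using (¬_; yes; no; contradiction)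
open import Relation.Nullary.Decidable using (⌊_⌋; _×-dec_)

-- A set of 2-element subsets {i , j} of Fin n, as a symmetric irreflexive
-- Boolean matrix.
record EdgeSet (n : ℕ) : Set where
  field
    edge   : Fin n → Fin n → Bool
    symm   : ∀ i j → edge i j ≡ edge j i
    irrefl : ∀ i → edge i i ≡ false

  Adj : Fin n → Fin n → Set
  Adj i j = T (edge i j)

open EdgeSet public using (edge; Adj)

-- A finite simple graph of order n has vertex set Fin n, so it is given by
-- its edges.
Graph : ℕ → Set
Graph = EdgeSet

-- Each edge {i , j} is counted once, at its ordered representative i < j.
size : ∀ {n} → EdgeSet n → ℕ
size {n} M =
  length (filter (λ (i , j) → (i <? j) ×-dec T? (edge M i j))
                 (cartesianProduct (allFin n) (allFin n)))

K : ∀ n → Graph n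
K n = record { edge = λ i j → not ⌊ i ≟ j ⌋ ; symm = symm ; irrefl = irrefl }
  where
  symm : ∀ i j → not ⌊ i ≟ j ⌋ ≡ not ⌊ j ≟ i ⌋
  symm i j with i ≟ j | j ≟ i
  ... | yes _ | yes _ = refl
  ... | no  _ | no  _ = refl
  ... | yes p | no ¬q = contradiction (sym p) ¬q
  ... | no ¬p | yes q = contradiction (sym q) ¬p

  irrefl : ∀ i → not ⌊ i ≟ i ⌋ ≡ false
  irrefl i with i ≟ i
  ... | yes _ = refl
  ... | no ¬p = contradiction refl ¬p

infixl 6 _∖_

_∖_ : ∀ {n} → Graph n → EdgeSet n → Graph n
G ∖ M = record
  { edge   = λ i j → edge G i j ∧ not (edge M i j)
  ; symm   = λ i j → cong₂ (λ a b → a ∧ not b) (EdgeSet.symm G i j) (EdgeSet.symm M i j)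
  ; irrefl = λ i → cong (_∧ not (edge M i i)) (EdgeSet.irrefl G i)
  }

infix 4 _≅_

_≅_ : ∀ {n} → Graph n → Graph n → Set
_≅_ {n} G H =
  Σ (Permutation′ n) λ π → ∀ i j → edge G i j ≡ edge H (π ⟨$⟩ʳ i) (π ⟨$⟩ʳ j)

Connected : ∀ {n} → Graph n → Set
Connected G = ∀ i j → Star (Adj G) i j

-- The cycle v, v₁, …, vₗ, v, with v, v₁, …, vₗ distinct and l ≥ 2.
record Cycle {n} (E : EdgeSet n) : Set where
  field
    start    : Fin n
    rest     : List (Fin n)
    long     : 2 ≤ length rest
    distinct : Unique (start ∷ rest)
    closed   : Linked (Adj E) (start ∷ rest ++ start ∷ [])

record Subgraph {n} (G : Graph n) : Set where
  field
    V     : Subset n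
    E     : EdgeSet n
    E⊆G   : ∀ {i j} → Adj E i j → Adj G i j
    ends∈ : ∀ {i j} → Adj E i j → i ∈ V × j ∈ V

open Subgraph public using (V; E)

record IsTree {n} {G : Graph n} (H : Subgraph G) : Set where
  field
    nonempty  : Nonempty (V H)
    connected : ∀ {i j} → i ∈ V H → j ∈ V H → Star (Adj (E H)) i j
    acyclic   : ¬ Cycle (E H)

record TreeConnecting {n} (G : Graph n) (S : Subset n) : Set where
  field
    tree   : Subgraph G
    isTree : IsTree tree
    S⊆V    : S ⊆ V tree

open TreeConnecting public using (tree)

InternallyDisjoint : ∀ {n} {G : Graph n} {S : Subset n} →
                     TreeConnecting G S → TreeConnecting G S → Set
InternallyDisjoint {S = S} t t′ =
  (∀ i j → Adj (E (tree t)) i j → Adj (E (tree t′)) i j → ⊥) ×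
  V (tree t) ∩ V (tree t′) ≡ S

DisjointTrees : ∀ {n} → Graph n → Subset n → ℕ → Set
DisjointTrees G S m =
  Σ (Fin m → TreeConnecting G S) λ t → ∀ i j → i ≢ j → InternallyDisjoint (t i) (t j)

IsMaximum : (ℕ → Set) → ℕ → Set
IsMaximum P m = P m × (∀ l → P l → l ≤ m)

IsMinimum : (ℕ → Set) → ℕ → Set
IsMinimum P m = P m × (∀ l → P l → m ≤ l)

-- κ(S) = m.  When |S| ≥ 2 every tree connecting S has an edge, so the members
-- of a pairwise internally disjoint family are distinct and the maximum exists.
Isκ : ∀ {n} → Graph n → Subset n → ℕ → Set
Isκ G S = IsMaximum (DisjointTrees G S)

-- κₖ(G) = c.
Isκₖ : ∀ {n} → ℕ → Graph n → ℕ → Set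
Isκₖ k G = IsMinimum (λ m → ∃ λ S → ∣ S ∣ ≡ k × Isκ G S m)

{-# OPTIONS --safe #-}
module Submission where

-- Upper bound.  In a connected subgraph through S with root r, the edges from
-- the vertices of S other than r to their breadth-first parents are distinct
-- and meet S.  Rooting outside S where possible, a tree with a vertex outside S
-- takes |S| of the edges of G that meet S, and a tree on S takes |S| − 1 of
-- those inside S; there are at most n − |S| trees of the first kind.  This gives
-- at most n − ⌈k/2⌉ trees, and in case of equality at most 0 (k even) or
-- (k − 1)/2 (k odd) missing edges that meet S.  If G misses more edges, a set S
-- containing an endpoint of sufficiently many of them violates this.
--
-- Lower bound. The complete graph on 2q + 1 vertices minus any q edges
-- decomposes into q connected spanning subgraphs: take out two vertices x and
-- y, where x lies on missing edges and y does not, decompose the rest, hang x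
-- and y onto each of the q − 1 old classes, and let the unused edges at x and
-- y, with some more edges reserved beforehand, form the last class. The
-- complete graph on 2q vertices is treated in the same way, with no missing
-- edges. Applied to S this gives trees on S, and each w outside S gives a star;
-- a missing edge ws is bypassed by a path w s′ s, whose edge s s′ is withdrawn
-- from S beforehand. Each missing edge thus costs at most one edge inside S.

import Algebra.Properties.Semiring.Sum
open import Data.Bool using (Bool; true; false; T; not; _∧_; if_then_else_)
open import Data.Bool.Properties using (T?)
open import Data.Empty using (⊥; ⊥-elim)
open import Data.Fin using (Fin; zero; suc; _≟_; toℕ; splitAt; join) renaming (_<_ to _<ᶠ_; _<?_ to _<ᶠ?_)
import Data.Fin.Permutation as Perm
open Perm using (_⟨$⟩ʳ_; _⟨$⟩ˡ_)
import Data.Fin.Properties as Fin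
open import Data.Fin.Subset using (Subset; _∈_; _∉_; _⊆_; _∪_; _∩_; ⁅_⁆; ∁; ∣_∣; Nonempty) renaming (⊤ to full)
open import Data.Fin.Subset.Properties
  using (_∈?_; nonempty?; Empty-unique; ∣⊥∣≡0; ∣⊤∣≡n; ⊆⊤; ⊆-antisym; ⊆-refl; x∈p∩q⁺; x∈p∩q⁻; x∈p∪q⁺; x∈p∪q⁻;
         p⊆p∪q; x∈⁅x⁆; x∈⁅y⁆⇒x≡y; x∈∁p⇒x∉p; ∣∁p∣≡n∸∣p∣; s⊆s)
open import Data.List using (List; []; _∷_; _++_; length; filter; map; take; lookup; allFin; cartesianProduct)
import Data.List.Membership.DecPropositional as DecMembership
open import Data.List.Membership.Propositional using () renaming (_∈_ to _∈ˡ_; _∉_ to _∉ˡ_)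
open import Data.List.Membership.Propositional.Properties
  using (∈-∃++; ∈-++⁺ˡ; ∈-++⁺ʳ; ∈-++⁻; ∈-filter⁺; ∈-filter⁻; ∈-map⁺; ∈-map⁻; ∈-lookup; ∈-cartesianProduct⁺; ∈-allFin)
open import Data.List.Properties using (length-++; length-map; length-take; ++-assoc)
open import Data.List.Relation.Binary.Permutation.Propositional using (_↭_; ↭-refl; ↭-sym; ↭-trans; ↭-reflexive; prep; ↭⇒↭ₛ)
open import Data.List.Relation.Binary.Permutation.Propositional.Properties using (↭-length; ∈-resp-↭; shift; ++-comm)
import Data.List.Relation.Binary.Permutation.Setoid.Properties as Permₛ
open import Data.List.Relation.Unary.All as All using (All; []; _∷_)
open import Data.List.Relation.Unary.AllPairs as AllPairs using ([]; _∷_)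
open import Data.List.Relation.Unary.Any using (here; there)
open import Data.List.Relation.Unary.Linked using (Linked; _∷_)
open import Data.List.Relation.Unary.Unique.Propositional using (Unique)
import Data.List.Relation.Unary.Unique.Propositional.Properties as Uniqueₚ
open Uniqueₚ using (Unique[x∷xs]⇒x∉xs)
open import Data.Nat using (ℕ; zero; suc; _+_; _*_; _∸_; _≤_; _<_; _≤?_; _<?_; z≤n; s≤s; s≤s⁻¹; ⌊_/2⌋; ⌈_/2⌉)
open import Data.Nat.Divisibility using (_∣_; divides; ∣m+n∣m⇒∣n; ∣⇒≤)
open import Data.Nat.Induction using (<-wellFounded)
import Data.Nat.Properties as ℕ
open import Data.Nat.Tactic.RingSolver using (solve-∀)
open import Data.Product using (Σ; ∃; ∃-syntax; _×_; _,_; proj₁; proj₂)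
open import Data.Product.Properties using (≡-dec)
open import Data.Sum using (_⊎_; inj₁; inj₂; [_,_]′; swap)
open import Data.Unit using (⊤; tt)
open import Data.Vec using (here; there; []; _∷_; tabulate)
open import Data.Vec.Properties using (lookup⇒[]=; []=⇒lookup; lookup∘tabulate)
open import Function using (_∘_)
open import Function.Bundles using (_⇔_; mk⇔)
open import Induction.WellFounded using (Acc; acc)
open import Relation.Binary.Construct.Closure.ReflexiveTransitive using (Star; ε; _◅_; _◅◅_; return; reverse) renaming (map to mapStar)
open import Relation.Binary.Definitions using (DecidableEquality; tri<; tri≈; tri>)
open import Relation.Binary.PropositionalEquality
open import Relation.Nullary using (¬_; Dec; does; yes; no; contradiction)
open import Relation.Nullary.Decidable
  using (⌊_⌋; ¬?; _⊎-dec_; _×-dec_; does-⇔; dec-true; dec-false; isYes≗does; toWitness; fromWitness; decidable-stable)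
open import Relation.Unary using (Decidable)
open import Defs

open Algebra.Properties.Semiring.Sum ℕ.+-*-semiring
  using (sum; sum-cong-≗; ∑-distrib-+; ∑-comm; *-distribˡ-sum; *-distribʳ-sum)

private variable A B Φ Ψ Ω : Set

-- Lists: removal, splitting and finite choice.

removeMember : ∀ {x : A} {xs} → x ∈ˡ xs → ∃[ ys ] xs ↭ x ∷ ys
removeMember x∈xs with ys , zs , refl ← ∈-∃++ x∈xs = ys ++ zs , shift _ ys zs

Unique-resp-↭ : ∀ {xs ys : List A} → xs ↭ ys → Unique xs → Unique ys
Unique-resp-↭ {A} p = Permₛ.Unique-resp-↭ (setoid A) (↭⇒↭ₛ p)

filter-↭-++ : ∀ {P : A → Set} (P? : Decidable P) xs →
              xs ↭ filter P? xs ++ filter (¬? ∘ P?) xs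
filter-↭-++ P? [] = ↭-refl
filter-↭-++ P? (x ∷ xs) with P? x
... | yes _ = prep x (filter-↭-++ P? xs)
... | no  _ = ↭-trans (prep x (filter-↭-++ P? xs)) (↭-sym (shift x _ _))

split₃ : ∀ m n (xs : List A) → m + n ≤ length xs →
         ∃[ us ] ∃[ vs ] ∃[ ws ] xs ≡ us ++ vs ++ ws × length us ≡ m × length vs ≡ n
split₃ zero    zero    xs       _ = [] , [] , xs , refl , refl , refl
split₃ zero    (suc n) (x ∷ xs) (s≤s le)
  with split₃ zero n xs le
... | [] , vs , ws , eq , refl , eqb = [] , x ∷ vs , ws , cong (x ∷_) eq , refl , cong suc eqb
split₃ (suc m) n       (x ∷ xs) (s≤s le)
  with us , vs , ws , eq , eqa , eqb ← split₃ m n xs le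
  = x ∷ us , vs , ws , cong (x ∷_) eq , cong suc eqa , eqb

Unique-++⁻ : ∀ (xs : List A) {ys} → Unique (xs ++ ys) →
             Unique xs × Unique ys × (∀ {a} → a ∈ˡ xs → a ∉ˡ ys)
Unique-++⁻ []       u = [] , u , λ ()
Unique-++⁻ (x ∷ xs) (x≢ ∷ u) with uxs , uys , dis ← Unique-++⁻ xs u
  = All.tabulate (λ a∈ → All.lookup x≢ (∈-++⁺ˡ a∈)) ∷ uxs , uys ,
    λ { (here refl) a∈ys → All.lookup x≢ (∈-++⁺ʳ xs a∈ys) refl
      ; (there a∈xs) → dis a∈xs }

-- Finite choice: a partner picked for each entry, kept as a list of pairs so that the number of
-- edges it spends is known.
selectPairs : ∀ {P : A → B → Set} (xs : List A) → (∀ {a} → a ∈ˡ xs → ∃ (P a)) →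
              Σ (List (A × B)) λ ps → length ps ≡ length xs ×
                (∀ {a} → a ∈ˡ xs → ∃[ b ] (a , b) ∈ˡ ps) ×
                (∀ {a b} → (a , b) ∈ˡ ps → a ∈ˡ xs × P a b)
selectPairs []       f = [] , refl , (λ ()) , λ ()
selectPairs (x ∷ xs) f with ps , len , total , sound ← selectPairs xs (f ∘ there)
                          | b , Pxb ← f (here refl)
  = (x , b) ∷ ps , cong suc len
  , (λ { (here refl) → b , here refl ; (there a∈) → let b′ , ∈ps = total a∈ in b′ , there ∈ps })
  , λ { (here refl) → here refl , Pxb ; (there ∈ps) → let a∈ , Pab = sound ∈ps in there a∈ , Pab }

-- A list of ordered pairs stands for a set of undirected edges. Loops and repetitions may occur, so
-- its length only bounds the number of edges.
Joined : List (A × A) → A → A → Set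
Joined F a b = (a , b) ∈ˡ F ⊎ (b , a) ∈ˡ F

Joined-sym : ∀ {F : List (A × A)} {a b} → Joined F a b → Joined F b a
Joined-sym = [ inj₂ , inj₁ ]′

Joined-map : ∀ {F F′ : List (A × A)} → (∀ {e} → e ∈ˡ F → e ∈ˡ F′) →
             ∀ {a b} → Joined F a b → Joined F′ a b
Joined-map f = [ inj₁ ∘ f , inj₂ ∘ f ]′

-- Decompositions of nearly complete graphs into connected spanning subgraphs.

module Decompose {A : Set} (_≟_ : DecidableEquality A) where

  open DecMembership _≟_ using () renaming (_∈?_ to _∈ˡ?_)

  -- Pigeonhole. When the head of `xs` occurs in `ys`, it is dropped from `xs` and one occurrence of
  -- it from `ys`; it cannot come back, since `xs` has no repetitions.
  fresh : ∀ {xs} ys → Unique xs → length ys < length xs → ∃[ a ] a ∈ˡ xs × a ∉ˡ ys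
  fresh {x ∷ xs} ys (x≢ ∷ u) lt with x ∈ˡ? ys
  ... | no x∉ = x , here refl , x∉
  ... | yes x∈ with zs , ys↭ ← removeMember x∈
                  with a , a∈xs , a∉zs ← fresh zs u (s≤s⁻¹ (subst (λ l → suc l ≤ _) (↭-length ys↭) lt))
      = a , there a∈xs ,
        λ a∈ys → case (∈-resp-↭ ys↭ a∈ys)
        where
        case : a ∈ˡ x ∷ zs → ⊥
        case (here refl) = All.lookup x≢ a∈xs refl
        case (there a∈zs) = a∉zs a∈zs

  unique⊆⇒length≤ : ∀ {xs ys} → Unique xs → (∀ {a} → a ∈ˡ xs → a ∈ˡ ys) → length xs ≤ length ys
  unique⊆⇒length≤ {xs} {ys} u sub = ℕ.≮⇒≥ λ lt → let _ , a∈ , a∉ = fresh ys u lt in a∉ (sub a∈)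

  joined? : ∀ F (a b : A) → Dec (Joined F a b)
  joined? F a b = ((a , b) ∈²? F) ⊎-dec ((b , a) ∈²? F)
    where open DecMembership (≡-dec _≟_ _≟_) using () renaming (_∈?_ to _∈²?_)

  -- The end opposite `x`; on a pair that avoids `x` the value is a mere default. Mapping it over
  -- `F` lists all vertices joined to `x`, at most `length F` of them.
  other : A → A × A → A
  other x (u , v) with u ≟ x
  ... | yes _ = v
  ... | no  _ = u

  joined⇒other : ∀ {F x b} → Joined F x b → b ∈ˡ map (other x) F
  joined⇒other {F} {x} {b} (inj₁ xb) = subst (_∈ˡ _) eq (∈-map⁺ (other x) xb)
    where
    eq : other x (x , b) ≡ b
    eq with x ≟ x
    ... | yes _ = refl
    ... | no ≢ = contradiction refl ≢
  joined⇒other {F} {x} {b} (inj₂ bx) = subst (_∈ˡ _) eq (∈-map⁺ (other x) bx)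
    where
    eq : other x (b , x) ≡ b
    eq with b ≟ x
    ... | yes b≡x = sym b≡x
    ... | no _ = refl

  Link : List A → (A → A → ℕ) → ℕ → A → A → Set
  Link R colour t a b = a ∈ˡ R × b ∈ˡ R × a ≢ b × colour a b ≡ t

  -- The colours t < q are pairwise edge-disjoint connected spanning subgraphs
  -- of the complete graph on R minus Forbidden; pairs of other colours are unused.
  record Decomposition (R : List A) (Forbidden : A → A → Set) (q : ℕ) : Set where
    field
      colour     : A → A → ℕ
      colour-sym : ∀ a b → colour a b ≡ colour b a
      connected  : ∀ {t} → t < q → ∀ {a b} → a ∈ˡ R → b ∈ˡ R → Star (Link R colour t) a b
      avoids     : ∀ {a b} → a ∈ˡ R → b ∈ˡ R → a ≢ b → Forbidden a b → q ≤ colour a b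

  Decomposition-resp : ∀ {R R′ Forbidden Forbidden′ q} → R ↭ R′ →
                       (∀ {a b} → a ∈ˡ R′ → b ∈ˡ R′ → a ≢ b → Forbidden′ a b → Forbidden a b) →
                       Decomposition R Forbidden q → Decomposition R′ Forbidden′ q
  Decomposition-resp R↭R′ F′⇒F D = record
    { colour     = colour
    ; colour-sym = colour-sym
    ; connected  = λ t<q a∈ b∈ →
        mapStar (λ (a∈ , b∈ , rest) → ∈-resp-↭ R↭R′ a∈ , ∈-resp-↭ R↭R′ b∈ , rest)
                (connected t<q (back a∈) (back b∈))
    ; avoids     = λ a∈ b∈ a≢b f → avoids (back a∈) (back b∈) a≢b (F′⇒F a∈ b∈ a≢b f)
    }
    where
    open Decomposition D
    back : ∀ {a} → a ∈ˡ _ → a ∈ˡ _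
    back = ∈-resp-↭ (↭-sym R↭R′)

  empty-decomposition : ∀ {R Forbidden} → Decomposition R Forbidden 0
  empty-decomposition = record
    { colour = λ _ _ → 0 ; colour-sym = λ _ _ → refl ; connected = λ () ; avoids = λ _ _ _ _ → z≤n }

  -- The index of b in xs; the value outside xs is suc (length xs), so that
  -- length xs is not taken.
  position : A → List A → ℕ
  position b [] = 1
  position b (x ∷ xs) with b ≟ x
  ... | yes _ = 0
  ... | no  _ = suc (position b xs)

  position-∉ : ∀ {b} xs → b ∉ˡ xs → position b xs ≡ suc (length xs)
  position-∉ []       _  = refl
  position-∉ {b} (x ∷ xs) b∉ with b ≟ x
  ... | yes refl = contradiction (here refl) b∉
  ... | no  _    = cong suc (position-∉ xs (b∉ ∘ there))

  position-onto : ∀ {t} xs → Unique xs → t < length xs → ∃[ b ] b ∈ˡ xs × position b xs ≡ t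
  position-onto {zero} (x ∷ xs) u _ = x , here refl , eq
    where
    eq : position x (x ∷ xs) ≡ 0
    eq with x ≟ x
    ... | yes _ = refl
    ... | no ≢ = contradiction refl ≢
  position-onto {suc t} (x ∷ xs) (x≢ ∷ u) (s≤s lt) with b , b∈ , eq ← position-onto xs u lt
    = b , there b∈ , eq′
    where
    eq′ : position b (x ∷ xs) ≡ suc t
    eq′ with b ≟ x
    ... | yes refl = contradiction refl (All.lookup x≢ b∈)
    ... | no _ = cong suc eq

  -- New vertices x and y are hung onto class t < q at the t-th vertex of X and
  -- of Y.  The new class q consists of the edge xy, the edges from x to As and
  -- from y to Bs, and the edges in Extra.
  module Extend
    {R} {Forbidden : A → A → Set} {q} (F : List (A × A)) (D : Decomposition R (Joined F) q)
    {x y} (x≢y : x ≢ y) (x∉R : x ∉ˡ R) (y∉R : y ∉ˡ R)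
    {As Bs X Y} (Extra : List (A × A))
    (As⊆R : ∀ {a} → a ∈ˡ As → a ∈ˡ R) (Bs⊆R : ∀ {a} → a ∈ˡ Bs → a ∈ˡ R)
    (X⊆R : ∀ {a} → a ∈ˡ X → a ∈ˡ R) (Y⊆R : ∀ {a} → a ∈ˡ Y → a ∈ˡ R)
    (X-unique : Unique X) (Y-unique : Unique Y)
    (X-length : length X ≡ q) (Y-length : length Y ≡ q)
    (X∩As : ∀ {a} → a ∈ˡ X → a ∉ˡ As) (Y∩Bs : ∀ {a} → a ∈ˡ Y → a ∉ˡ Bs)
    -- In the new class a vertex of `R` hangs on `x` or `y`, or is one reserved edge away from such
    -- a vertex.
    (cover : ∀ {a} → a ∈ˡ R → (a ∈ˡ As ⊎ a ∈ˡ Bs) ⊎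
               ∃[ b ] (b ∈ˡ As ⊎ b ∈ˡ Bs) × a ≢ b × Joined Extra a b)
    -- The reserved edges are forbidden to the old classes, which leaves them free for class `q`.
    (Extra⊆F : ∀ {a b} → Joined Extra a b → Joined F a b)
    (Forbidden-sym : ∀ {a b} → Forbidden a b → Forbidden b a)
    (Forbidden-x : ∀ {b} → Forbidden x b → b ∉ˡ As × b ∉ˡ X)
    (Forbidden-y : ∀ {b} → ¬ Forbidden y b)
    (Forbidden-R : ∀ {a b} → a ∈ˡ R → b ∈ˡ R → Forbidden a b → Joined F a b × ¬ Joined Extra a b)
    where

    private module D = Decomposition D

    xColour : A → ℕ
    xColour b with b ∈ˡ? (y ∷ As)
    ... | yes _ = q
    ... | no  _ = position b X

    yColour : A → ℕ
    yColour b with b ∈ˡ? Bs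
    ... | yes _ = q
    ... | no  _ = position b Y

    recolour : ℕ → Bool → ℕ
    recolour c extra with c <? q
    ... | yes _ = c
    ... | no  _ = if extra then q else suc q

    innerColour : A → A → ℕ
    innerColour a b = recolour (D.colour a b) (does (joined? Extra a b))

    colour : A → A → ℕ
    colour a b with a ≟ x | b ≟ x | a ≟ y | b ≟ y
    ... | yes _ | _     | _     | _     = xColour b
    ... | no  _ | yes _ | _     | _     = xColour a
    ... | no  _ | no  _ | yes _ | _     = yColour b
    ... | no  _ | no  _ | no  _ | yes _ = yColour a
    ... | no  _ | no  _ | no  _ | no  _ = innerColour a b

    innerColour-sym : ∀ a b → innerColour a b ≡ innerColour b a
    innerColour-sym a b = cong₂ recolour (D.colour-sym a b)
      (does-⇔ (mk⇔ Joined-sym Joined-sym) (joined? Extra a b) (joined? Extra b a))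

    colour-sym : ∀ a b → colour a b ≡ colour b a
    colour-sym a b with a ≟ x | b ≟ x | a ≟ y | b ≟ y
    ... | yes refl | yes refl | _     | _     = refl
    ... | yes _ | no  _ | _     | _     = refl
    ... | no  _ | yes _ | _     | _     = refl
    ... | no  _ | no  _ | yes refl | yes refl = refl
    ... | no  _ | no  _ | yes _ | no _  = refl
    ... | no  _ | no  _ | no  _ | yes _ = refl
    ... | no  _ | no  _ | no  _ | no  _ = innerColour-sym a b

    R′ : List A
    R′ = x ∷ y ∷ R

    x∈R′ : x ∈ˡ R′
    x∈R′ = here refl

    y∈R′ : y ∈ˡ R′
    y∈R′ = there (here refl)

    R⊆R′ : ∀ {a} → a ∈ˡ R → a ∈ˡ R′
    R⊆R′ a∈R = there (there a∈R)

    ∈R⇒≢x : ∀ {a} → a ∈ˡ R → a ≢ x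
    ∈R⇒≢x a∈R refl = x∉R a∈R

    ∈R⇒≢y : ∀ {a} → a ∈ˡ R → a ≢ y
    ∈R⇒≢y a∈R refl = y∉R a∈R

    colour-x : ∀ b → colour x b ≡ xColour b
    colour-x b with x ≟ x
    ... | yes _ = refl
    ... | no ≢ = contradiction refl ≢

    colour-y : ∀ {b} → b ∈ˡ R → colour y b ≡ yColour b
    colour-y {b} b∈R with y ≟ x | b ≟ x | y ≟ y
    ... | yes refl | _ | _ = contradiction refl x≢y
    ... | no _ | yes refl | _ = contradiction b∈R x∉R
    ... | no _ | no _ | yes _ = refl
    ... | no _ | no _ | no ≢ = contradiction refl ≢

    colour-R : ∀ {a b} → a ∈ˡ R → b ∈ˡ R → colour a b ≡ innerColour a b
    colour-R {a} {b} a∈R b∈R with a ≟ x | b ≟ x | a ≟ y | b ≟ y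
    ... | yes refl | _ | _ | _ = contradiction a∈R x∉R
    ... | no _ | yes refl | _ | _ = contradiction b∈R x∉R
    ... | no _ | no _ | yes refl | _ = contradiction a∈R y∉R
    ... | no _ | no _ | no _ | yes refl = contradiction b∈R y∉R
    ... | no _ | no _ | no _ | no _ = refl

    xColour-new : ∀ {b} → b ∈ˡ y ∷ As → xColour b ≡ q
    xColour-new {b} b∈ with b ∈ˡ? (y ∷ As)
    ... | yes _ = refl
    ... | no b∉ = contradiction b∈ b∉

    xColour-old : ∀ {b} → b ∉ˡ y ∷ As → xColour b ≡ position b X
    xColour-old {b} b∉ with b ∈ˡ? (y ∷ As)
    ... | yes b∈ = contradiction b∈ b∉
    ... | no _ = refl

    yColour-new : ∀ {b} → b ∈ˡ Bs → yColour b ≡ q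
    yColour-new {b} b∈ with b ∈ˡ? Bs
    ... | yes _ = refl
    ... | no b∉ = contradiction b∈ b∉

    yColour-old : ∀ {b} → b ∉ˡ Bs → yColour b ≡ position b Y
    yColour-old {b} b∉ with b ∈ˡ? Bs
    ... | yes b∈ = contradiction b∈ b∉
    ... | no _ = refl

    innerColour-old : ∀ {a b} → D.colour a b < q → innerColour a b ≡ D.colour a b
    innerColour-old {a} {b} lt with D.colour a b <? q
    ... | yes _ = refl
    ... | no ≮ = contradiction lt ≮

    innerColour-new : ∀ {a b} → a ∈ˡ R → b ∈ˡ R → a ≢ b → Joined Extra a b → innerColour a b ≡ q
    innerColour-new {a} {b} a∈ b∈ a≢b e with D.colour a b <? q
    ... | yes lt = contradiction lt (ℕ.≤⇒≯ (D.avoids a∈ b∈ a≢b (Extra⊆F e)))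
    ... | no _ = cong (if_then q else suc q) (dec-true (joined? Extra a b) e)

    innerColour-unused : ∀ {a b} → a ∈ˡ R → b ∈ˡ R → a ≢ b → Forbidden a b → innerColour a b ≡ suc q
    innerColour-unused {a} {b} a∈ b∈ a≢b f with D.colour a b <? q
    ... | yes lt = contradiction lt (ℕ.≤⇒≯ (D.avoids a∈ b∈ a≢b (proj₁ (Forbidden-R a∈ b∈ f))))
    ... | no _ = cong (if_then q else suc q) (dec-false (joined? Extra a b) (proj₂ (Forbidden-R a∈ b∈ f)))

    Link-sym : ∀ {t a b} → Link R′ colour t a b → Link R′ colour t b a
    Link-sym (a∈ , b∈ , a≢b , eq) = b∈ , a∈ , a≢b ∘ sym , trans (colour-sym _ _) eq

    viaHub : ∀ {t} h → (∀ {a} → a ∈ˡ R′ → Star (Link R′ colour t) a h) →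
             ∀ {a b} → a ∈ˡ R′ → b ∈ˡ R′ → Star (Link R′ colour t) a b
    viaHub h toHub a∈ b∈ = toHub a∈ ◅◅ reverse Link-sym (toHub b∈)

    -- The old class already connects `R`; `x` hangs on the `t`-th vertex of `X`, which serves as
    -- hub, and `y` on the `t`-th vertex of `Y`.
    oldClass : ∀ {t} → t < q → ∀ {a b} → a ∈ˡ R′ → b ∈ˡ R′ → Star (Link R′ colour t) a b
    oldClass {t} t<q
      with b , b∈X , posb ← position-onto {t} X X-unique (subst (t <_) (sym X-length) t<q)
         | c , c∈Y , posc ← position-onto {t} Y Y-unique (subst (t <_) (sym Y-length) t<q)
      = viaHub b toHub
      where
      inside : ∀ {a} → a ∈ˡ R → Star (Link R′ colour t) a b
      inside a∈R = mapStar
        (λ { (a∈ , b∈ , a≢b , refl) → R⊆R′ a∈ , R⊆R′ b∈ , a≢b , trans (colour-R a∈ b∈) (innerColour-old t<q) })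
        (D.connected t<q a∈R (X⊆R b∈X))
      toHub : ∀ {a} → a ∈ˡ R′ → Star (Link R′ colour t) a b
      toHub (here refl) = return (x∈R′ , R⊆R′ (X⊆R b∈X) , ∈R⇒≢x (X⊆R b∈X) ∘ sym ,
        trans (colour-x b) (trans (xColour-old λ { (here refl) → y∉R (X⊆R b∈X) ; (there b∈As) → X∩As b∈X b∈As }) posb))
      toHub (there (here refl)) =
        (y∈R′ , R⊆R′ (Y⊆R c∈Y) , ∈R⇒≢y (Y⊆R c∈Y) ∘ sym ,
          trans (colour-y (Y⊆R c∈Y)) (trans (yColour-old (Y∩Bs c∈Y)) posc))
        ◅ inside (Y⊆R c∈Y)
      toHub (there (there a∈R)) = inside a∈R

    -- The hub `y` is reached from `x` over the edge xy, from `As` over `x`, from `Bs` directly, and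
    -- from all other vertices over a reserved edge to `As` or `Bs`.
    newClass : ∀ {a b} → a ∈ˡ R′ → b ∈ˡ R′ → Star (Link R′ colour q) a b
    newClass = viaHub y toHub
      where
      x⟶y : Star (Link R′ colour q) x y
      x⟶y = return (x∈R′ , y∈R′ , x≢y , trans (colour-x y) (xColour-new (here refl)))
      hung : ∀ {a} → a ∈ˡ As ⊎ a ∈ˡ Bs → Star (Link R′ colour q) a y
      hung (inj₁ a∈) =
        (R⊆R′ (As⊆R a∈) , x∈R′ , ∈R⇒≢x (As⊆R a∈) ,
          trans (colour-sym _ _) (trans (colour-x _) (xColour-new (there a∈))))
        ◅ x⟶y
      hung (inj₂ a∈) = return
        (R⊆R′ (Bs⊆R a∈) , y∈R′ , ∈R⇒≢y (Bs⊆R a∈) ,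
          trans (colour-sym _ _) (trans (colour-y (Bs⊆R a∈)) (yColour-new a∈)))
      hung⊆R : ∀ {a} → a ∈ˡ As ⊎ a ∈ˡ Bs → a ∈ˡ R
      hung⊆R = [ As⊆R , Bs⊆R ]′
      toHub : ∀ {a} → a ∈ˡ R′ → Star (Link R′ colour q) a y
      toHub (here refl) = x⟶y
      toHub (there (here refl)) = ε
      toHub (there (there a∈R)) with cover a∈R
      ... | inj₁ h = hung h
      ... | inj₂ (b , h , a≢b , e) =
        (R⊆R′ a∈R , R⊆R′ (hung⊆R h) , a≢b ,
          trans (colour-R a∈R (hung⊆R h)) (innerColour-new a∈R (hung⊆R h) a≢b e))
        ◅ hung h

    -- Forbidden pairs get exactly the colour `suc q`: at `x` because the other end lies outside
    -- `As` and `X`, inside `R` because the pair is forbidden in `D` and not reserved. None contains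
    -- `y`.
    avoids : ∀ {a b} → a ∈ˡ R′ → b ∈ˡ R′ → a ≢ b → Forbidden a b → suc q ≤ colour a b
    avoids a∈ b∈ a≢b f = ℕ.≤-reflexive (sym (unused a∈ b∈ a≢b f))
      where
      unused-x : ∀ {b} → b ∈ˡ R → Forbidden x b → colour x b ≡ suc q
      unused-x {b} b∈R f = trans (colour-x b) (trans (xColour-old
        λ { (here refl) → y∉R b∈R ; (there b∈As) → proj₁ (Forbidden-x f) b∈As })
        (trans (position-∉ X (proj₂ (Forbidden-x f))) (cong suc X-length)))
      unused : ∀ {a b} → a ∈ˡ R′ → b ∈ˡ R′ → a ≢ b → Forbidden a b → colour a b ≡ suc q
      unused (there (here refl)) _ _ f = contradiction f Forbidden-y
      unused _ (there (here refl)) _ f = contradiction (Forbidden-sym f) Forbidden-y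
      unused (here refl) (here refl) ≢ _ = contradiction refl ≢
      unused (here refl) (there (there b∈R)) _ f = unused-x b∈R f
      unused (there (there a∈R)) (here refl) _ f = trans (colour-sym _ _) (unused-x a∈R (Forbidden-sym f))
      unused (there (there a∈R)) (there (there b∈R)) a≢b f = trans (colour-R a∈R b∈R) (innerColour-unused a∈R b∈R a≢b f)

    extended : Decomposition R′ Forbidden (suc q)
    extended = record
      { colour = colour ; colour-sym = colour-sym ; avoids = avoids
      ; connected = λ {t} t<1+q a∈ b∈ → class t (ℕ.m<1+n⇒m<n∨m≡n t<1+q) a∈ b∈ }
      where
      class : ∀ t → t < q ⊎ t ≡ q → ∀ {a b} → a ∈ˡ R′ → b ∈ˡ R′ → Star (Link R′ colour t) a b
      class t (inj₁ t<q) = oldClass t<q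
      class t (inj₂ refl) = newClass

  -- Induction, two vertices at a time. The others fall into halves `As` and `Bs`: in the new class
  -- `x` takes `As` and `y` takes `Bs`, which covers every vertex; in the old classes they use the
  -- opposite halves.
  evenDecomposition : ∀ q {R} → Unique R → length R ≡ q + q → Decomposition R (Joined []) q
  evenDecomposition zero _ _ = empty-decomposition
  evenDecomposition (suc q) {_ ∷ []} _ eq with () ← trans (ℕ.suc-injective eq) (ℕ.+-suc q q)
  evenDecomposition (suc q) {x ∷ y ∷ R} ((x≢y ∷ x∉R) ∷ y∉R ∷ u) eq
    with R-length ← ℕ.suc-injective (trans (ℕ.suc-injective eq) (ℕ.+-suc q q))
    with split₃ q q R (ℕ.≤-reflexive (sym R-length))
  -- Two halves of length `q` exhaust `R`, so a nonempty third part is absurd.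
  ... | As , Bs , w ∷ Ws , refl , refl , eqB = contradiction (trans (sym R-length) count) (ℕ.m≢1+m+n _)
    where
    count : length (As ++ Bs ++ w ∷ Ws) ≡ suc (length As + length As + length Ws)
    count = trans (length-++ As) (trans
      (cong (length As +_) (trans (length-++ Bs) (cong (_+ suc (length Ws)) eqB)))
      (arith (length As) (length Ws)))
      where
      arith : ∀ a w → a + (a + suc w) ≡ suc (a + a + w)
      arith = solve-∀
  ... | As , Bs , [] , refl , refl , eqB
    with As-unique , BsW-unique , disjoint ← Unique-++⁻ As u
    with Bs-unique , _ , _ ← Unique-++⁻ Bs BsW-unique
    = Extend.extended [] (evenDecomposition (length As) u R-length) x≢y
        (λ x∈ → All.lookup x∉R x∈ refl) (λ y∈ → All.lookup y∉R y∈ refl) {As} {Bs} {Bs} {As} []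
        ∈-++⁺ˡ Bs⊆ Bs⊆ ∈-++⁺ˡ Bs-unique As-unique eqB refl
        (λ b∈ a∈ → disjoint a∈ (∈-++⁺ˡ b∈)) (λ a∈ b∈ → disjoint a∈ (∈-++⁺ˡ b∈))
        (inj₁ ∘ cover) (λ { (inj₁ ()) ; (inj₂ ()) }) (λ { (inj₁ ()) ; (inj₂ ()) })
        (λ { (inj₁ ()) ; (inj₂ ()) }) (λ { (inj₁ ()) ; (inj₂ ()) }) (λ { _ _ (inj₁ ()) ; _ _ (inj₂ ()) })
    where
    Bs⊆ : ∀ {b} → b ∈ˡ Bs → b ∈ˡ As ++ Bs ++ []
    Bs⊆ = ∈-++⁺ʳ As ∘ ∈-++⁺ˡ
    cover : ∀ {a} → a ∈ˡ As ++ Bs ++ [] → a ∈ˡ As ⊎ a ∈ˡ Bs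
    cover a∈ with ∈-++⁻ As a∈
    ... | inj₁ a∈As = inj₁ a∈As
    ... | inj₂ a∈′ with ∈-++⁻ Bs a∈′
    ... | inj₁ a∈Bs = inj₂ a∈Bs

  Touches : A → A × A → Set
  Touches x (u , v) = u ≡ x ⊎ v ≡ x

  touches? : ∀ x → Decidable (Touches x)
  touches? x (u , v) = (u ≟ x) ⊎-dec (v ≟ x)

  -- The first endpoint of some pair may be taken in R, a pair that misses R
  -- being replaced by a loop.
  pointed : ∀ {q} {R : List A} (F : List (A × A)) → 0 < length R → length F ≤ suc q →
            ∃[ x ] ∃[ v ] ∃[ F′ ] x ∈ˡ R × length F′ ≤ q ×
              (∀ {a b} → a ∈ˡ R → b ∈ˡ R → Joined F a b → Joined ((x , v) ∷ F′) a b)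
  pointed {R = r ∷ R} [] _ _ =
    r , r , [] , here refl , z≤n , λ { _ _ (inj₁ ()) ; _ _ (inj₂ ()) }
  pointed {R = r ∷ R} ((u , v) ∷ F) _ (s≤s le) with u ∈ˡ? (r ∷ R)
  ... | yes u∈ = u , v , F , u∈ , le , λ _ _ j → j
  ... | no u∉ = r , r , F , here refl , le ,
    λ { a∈ b∈ (inj₁ (here refl)) → contradiction a∈ u∉
      ; a∈ b∈ (inj₁ (there p)) → inj₁ (there p)
      ; a∈ b∈ (inj₂ (here refl)) → contradiction b∈ u∉
      ; a∈ b∈ (inj₂ (there p)) → inj₂ (there p) }

  removeTwo : ∀ {R} {x y : A} → x ∈ˡ R → y ∈ˡ R → x ≢ y → ∃[ R′ ] R ↭ x ∷ y ∷ R′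
  removeTwo x∈ y∈ x≢y with R₁ , R↭ ← removeMember x∈ with ∈-resp-↭ R↭ y∈
  ... | here refl = contradiction refl x≢y
  ... | there y∈R₁ with R′ , R₁↭ ← removeMember y∈R₁ = R′ , ↭-trans R↭ (prep _ R₁↭)

  -- For Extend, with N the vertices that may not be joined to x, Bs = c₀ ∷ X and
  -- Y = As ++ Cs; extra edges join Cs to the rest.
  record Arrangement (R : List A) (N : A → Set) (a q f : ℕ) : Set where
    field
      As X Cs   : List A
      c₀        : A
    vertices : List A
    vertices = As ++ X ++ c₀ ∷ Cs
    field
      R↭        : R ↭ vertices
      As-length : length As ≡ a
      X-length  : length X ≡ q
      Cs-length : length Cs ≡ f
      As-avoid  : ∀ {b} → b ∈ˡ As → ¬ N b
      X-avoid   : ∀ {b} → b ∈ˡ X → ¬ N b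

  -- At most `f + 1` vertices satisfy `N`, so at least `a + q` do not; `As` and `X` are cut from
  -- these. What is left has length `f + 1` and supplies `c₀` and `Cs`.
  arrange : ∀ {N : A → Set} (N? : Decidable N) (R : List A) a q f →
            length R ≡ a + (q + suc f) → length (filter N? R) ≤ suc f →
            Arrangement R N a q f
  arrange N? R a q f len few = go (split₃ a q P enough)
    where
    P Q : List A
    P = filter (¬? ∘ N?) R
    Q = filter N? R
    R↭P++Q : R ↭ P ++ Q
    R↭P++Q = ↭-trans (filter-↭-++ N? R) (++-comm Q P)
    PQ-length : length P + length Q ≡ a + (q + suc f)
    PQ-length = trans (sym (length-++ P)) (trans (sym (↭-length R↭P++Q)) len)
    enough : a + q ≤ length P
    enough = ℕ.+-cancelʳ-≤ (suc f) _ _ (begin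
      a + q + suc f        ≡⟨ ℕ.+-assoc a q (suc f) ⟩
      a + (q + suc f)      ≡⟨ PQ-length ⟨
      length P + length Q  ≤⟨ ℕ.+-monoʳ-≤ (length P) few ⟩
      length P + suc f     ∎)
      where open ℕ.≤-Reasoning
    go : ∃[ As ] ∃[ X ] ∃[ Ws ] P ≡ As ++ X ++ Ws × length As ≡ a × length X ≡ q → Arrangement R _ a q f
    go (As , X , Ws , P≡ , As-length , X-length) = finish (Ws ++ Q) refl
      where
      R↭′ : R ↭ As ++ X ++ Ws ++ Q
      R↭′ = ↭-trans R↭P++Q (↭-reflexive (trans (cong (_++ Q) P≡)
              (trans (++-assoc As (X ++ Ws) Q) (cong (As ++_) (++-assoc X Ws Q)))))
      rest-length : length (Ws ++ Q) ≡ suc f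
      rest-length = ℕ.+-cancelˡ-≡ q _ _ (ℕ.+-cancelˡ-≡ a _ _ (begin
        a + (q + length (Ws ++ Q))                ≡⟨ cong₂ (λ s t → s + (t + length (Ws ++ Q))) (sym As-length) (sym X-length) ⟩
        length As + (length X + length (Ws ++ Q)) ≡⟨ cong (length As +_) (length-++ X) ⟨
        length As + length (X ++ Ws ++ Q)         ≡⟨ length-++ As ⟨
        length (As ++ X ++ Ws ++ Q)               ≡⟨ ↭-length R↭′ ⟨
        length R                                  ≡⟨ len ⟩
        a + (q + suc f)                           ∎))
        where open ≡-Reasoning
      avoid : ∀ {b} → b ∈ˡ As ++ X ++ Ws → ¬ _
      avoid b∈ = proj₂ (∈-filter⁻ (¬? ∘ N?) {xs = R} (subst (_ ∈ˡ_) (sym P≡) b∈))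
      finish : ∀ Ts → Ws ++ Q ≡ Ts → Arrangement R _ a q f
      finish [] eq with () ← trans (sym rest-length) (cong length eq)
      finish (c₀ ∷ Cs) eq = record
        { As = As ; X = X ; Cs = Cs ; c₀ = c₀
        ; R↭ = ↭-trans R↭′ (↭-reflexive (cong (λ T → As ++ X ++ T) eq))
        ; As-length = As-length ; X-length = X-length
        ; Cs-length = ℕ.suc-injective (trans (sym (cong length eq)) rest-length)
        ; As-avoid = λ b∈ → avoid (∈-++⁺ˡ b∈)
        ; X-avoid = λ b∈ → avoid (∈-++⁺ʳ As (∈-++⁺ˡ b∈)) }

  -- x becomes the first new vertex of Extend, and y a vertex that lies on no
  -- pair; the f + 1 pairs at x are replaced by f extra edges.
  module OddStep
    {q x v y a f R₀} {F : List (A × A)}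
    (F′-length : length (filter (¬? ∘ touches? x) F) ≤ a) (a+f : a + f ≡ q)
    (y-isolated : ∀ {b} → ¬ Joined ((x , v) ∷ F) y b)
    (arrangement : Arrangement R₀ (Joined ((x , v) ∷ F) x) a q f)
    (R₁-length : length (Arrangement.vertices arrangement) ≡ suc (q + q))
    (all-unique : Unique (x ∷ y ∷ Arrangement.vertices arrangement))
    (hypothesis : ∀ {R} F → Unique R → length R ≡ suc (q + q) → length F ≤ q →
                  Decomposition R (Joined F) q)
    where

    open Arrangement arrangement renaming (vertices to R₁)

    F⁺ F′ : List (A × A)
    F⁺ = (x , v) ∷ F
    F′ = filter (¬? ∘ touches? x) F

    x≢y : x ≢ y
    x≢y x≡y = Unique[x∷xs]⇒x∉xs all-unique (here x≡y)

    R₁-unique : Unique R₁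
    R₁-unique = AllPairs.tail (AllPairs.tail all-unique)

    x∉R₁ : x ∉ˡ R₁
    x∉R₁ = Unique[x∷xs]⇒x∉xs all-unique ∘ there

    y∉R₁ : y ∉ˡ R₁
    y∉R₁ = Unique[x∷xs]⇒x∉xs (AllPairs.tail all-unique)

    -- The vertices reached by the new class without extra edges.
    Zs : List A
    Zs = c₀ ∷ As ++ X

    hung : ∀ {b} → b ∈ˡ Zs → b ∈ˡ As ⊎ b ∈ˡ c₀ ∷ X
    hung (here refl) = inj₂ (here refl)
    hung (there b∈) with ∈-++⁻ As b∈
    ... | inj₁ b∈As = inj₁ b∈As
    ... | inj₂ b∈X = inj₂ (there b∈X)

    As⊆ : ∀ {b} → b ∈ˡ As → b ∈ˡ R₁
    As⊆ = ∈-++⁺ˡ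
    X⊆ : ∀ {b} → b ∈ˡ X → b ∈ˡ R₁
    X⊆ = ∈-++⁺ʳ As ∘ ∈-++⁺ˡ
    c₀Cs⊆ : ∀ {b} → b ∈ˡ c₀ ∷ Cs → b ∈ˡ R₁
    c₀Cs⊆ = ∈-++⁺ʳ As ∘ ∈-++⁺ʳ X
    Bs⊆ : ∀ {b} → b ∈ˡ c₀ ∷ X → b ∈ˡ R₁
    Bs⊆ (here refl) = c₀Cs⊆ (here refl)
    Bs⊆ (there b∈) = X⊆ b∈
    Zs⊆ : ∀ {b} → b ∈ˡ Zs → b ∈ˡ R₁
    Zs⊆ = [ As⊆ , Bs⊆ ]′ ∘ hung

    split-As : Unique As × Unique (X ++ c₀ ∷ Cs) × (∀ {b} → b ∈ˡ As → b ∉ˡ X ++ c₀ ∷ Cs)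
    split-As = Unique-++⁻ As R₁-unique
    As-disjoint : ∀ {b} → b ∈ˡ As → b ∉ˡ X ++ c₀ ∷ Cs
    As-disjoint = proj₂ (proj₂ split-As)
    split-X : Unique X × Unique (c₀ ∷ Cs) × (∀ {b} → b ∈ˡ X → b ∉ˡ c₀ ∷ Cs)
    split-X = Unique-++⁻ X (proj₁ (proj₂ split-As))
    X-disjoint : ∀ {b} → b ∈ˡ X → b ∉ˡ c₀ ∷ Cs
    X-disjoint = proj₂ (proj₂ split-X)

    c₀∉Cs : c₀ ∉ˡ Cs
    c₀∉Cs = Unique[x∷xs]⇒x∉xs (proj₁ (proj₂ split-X))

    Cs-unique : Unique Cs
    Cs-unique = AllPairs.tail (proj₁ (proj₂ split-X))

    Cs∩Zs : ∀ {c} → c ∈ˡ Cs → c ∉ˡ Zs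
    Cs∩Zs c∈ (here refl) = c₀∉Cs c∈
    Cs∩Zs c∈ (there c∈′) with ∈-++⁻ As c∈′
    ... | inj₁ c∈As = As-disjoint c∈As (∈-++⁺ʳ X (there c∈))
    ... | inj₂ c∈X = X-disjoint c∈X (there c∈)

    Zs-unique : Unique Zs
    Zs-unique = All.tabulate c₀≢ ∷ Uniqueₚ.++⁺ (proj₁ split-As) (proj₁ split-X)
      (λ (a∈ , x∈) → As-disjoint a∈ (∈-++⁺ˡ x∈))
      where
      c₀≢ : ∀ {b} → b ∈ˡ As ++ X → c₀ ≢ b
      c₀≢ b∈ refl with ∈-++⁻ As b∈
      ... | inj₁ c₀∈As = As-disjoint c₀∈As (∈-++⁺ʳ X (here refl))
      ... | inj₂ c₀∈X = X-disjoint c₀∈X (here refl)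

    -- A pair inside `R₁` does not contain `x`, so it survives the filter that drops the pairs at
    -- `x`.
    avoidsX : ∀ {b e} → b ∈ˡ R₁ → e ∈ˡ R₁ → Joined F⁺ b e → Joined F′ b e
    avoidsX b∈ e∈ (inj₁ (here refl)) = contradiction b∈ x∉R₁
    avoidsX b∈ e∈ (inj₁ (there p)) = inj₁ (∈-filter⁺ (¬? ∘ touches? x) p
      λ { (inj₁ refl) → x∉R₁ b∈ ; (inj₂ refl) → x∉R₁ e∈ })
    avoidsX b∈ e∈ (inj₂ (here refl)) = contradiction e∈ x∉R₁
    avoidsX b∈ e∈ (inj₂ (there p)) = inj₂ (∈-filter⁺ (¬? ∘ touches? x) p
      λ { (inj₁ refl) → x∉R₁ e∈ ; (inj₂ refl) → x∉R₁ b∈ })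

    F′<Zs : ∀ c → length (map (other c) F′) < length Zs
    F′<Zs c = s≤s (begin
      length (map (other c) F′) ≡⟨ length-map (other c) F′ ⟩
      length F′                 ≤⟨ F′-length ⟩
      a                         ≡⟨ As-length ⟨
      length As                 ≤⟨ ℕ.m≤m+n _ _ ⟩
      length As + length X      ≡⟨ length-++ As ⟨
      length (As ++ X)          ∎)
      where open ℕ.≤-Reasoning

    -- `Zs` has a + q + 1 vertices and `F′` at most a pairs, so `c` cannot be forbidden to all of
    -- `Zs`.
    partner : ∀ {c} → c ∈ˡ Cs → ∃[ z ] z ∈ˡ Zs × ¬ Joined F⁺ c z
    partner {c} c∈ with z , z∈ , z∉ ← fresh (map (other c) F′) Zs-unique (F′<Zs c)
      = z , z∈ , λ j → z∉ (joined⇒other (avoidsX (c₀Cs⊆ (there c∈)) (Zs⊆ z∈) j))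

    extras = selectPairs Cs partner
    Extra : List (A × A)
    Extra = proj₁ extras

    Extra-sound : ∀ {c z} → (c , z) ∈ˡ Extra → c ∈ˡ Cs × z ∈ˡ Zs × ¬ Joined F⁺ c z
    Extra-sound = proj₂ (proj₂ (proj₂ extras))

    -- The list forbidden to the old classes. The `f` reserved edges take the place of pairs at `x`,
    -- so its length stays within `q`.
    FE : List (A × A)
    FE = F′ ++ Extra

    FE-length : length FE ≤ q
    FE-length = begin
      length FE                  ≡⟨ length-++ F′ ⟩
      length F′ + length Extra   ≡⟨ cong (length F′ +_) (trans (proj₁ (proj₂ extras)) Cs-length) ⟩
      length F′ + f              ≤⟨ ℕ.+-monoˡ-≤ f F′-length ⟩
      a + f                      ≡⟨ a+f ⟩
      q                          ∎
      where open ℕ.≤-Reasoning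

    -- The complement of `c₀ ∷ X` in `R₁`: the vertices whose edges to `y` are left for the old
    -- classes.
    Ys : List A
    Ys = As ++ Cs

    Ys⊆ : ∀ {b} → b ∈ˡ Ys → b ∈ˡ R₁
    Ys⊆ = [ As⊆ , c₀Cs⊆ ∘ there ]′ ∘ ∈-++⁻ As

    Ys-unique : Unique Ys
    Ys-unique = Uniqueₚ.++⁺ (proj₁ split-As) Cs-unique (λ (a∈ , c∈) → As-disjoint a∈ (∈-++⁺ʳ X (there c∈)))

    Ys-length : length Ys ≡ q
    Ys-length = trans (length-++ As) (trans (cong₂ _+_ As-length Cs-length) a+f)

    Ys∩Bs : ∀ {b} → b ∈ˡ Ys → b ∉ˡ c₀ ∷ X
    Ys∩Bs b∈ b∈Bs with ∈-++⁻ As b∈ | b∈Bs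
    ... | inj₁ b∈As | here refl = As-disjoint b∈As (∈-++⁺ʳ X (here refl))
    ... | inj₁ b∈As | there b∈X = As-disjoint b∈As (∈-++⁺ˡ b∈X)
    ... | inj₂ b∈Cs | here refl = c₀∉Cs b∈Cs
    ... | inj₂ b∈Cs | there b∈X = X-disjoint b∈X (there b∈Cs)

    cover : ∀ {b} → b ∈ˡ R₁ → (b ∈ˡ As ⊎ b ∈ˡ c₀ ∷ X) ⊎
              ∃[ z ] (z ∈ˡ As ⊎ z ∈ˡ c₀ ∷ X) × b ≢ z × Joined Extra b z
    cover b∈ with ∈-++⁻ As b∈
    ... | inj₁ b∈As = inj₁ (inj₁ b∈As)
    ... | inj₂ b∈′ with ∈-++⁻ X b∈′
    ... | inj₁ b∈X = inj₁ (inj₂ (there b∈X))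
    ... | inj₂ (here refl) = inj₁ (inj₂ (here refl))
    ... | inj₂ (there b∈Cs) with z , bz ← proj₁ (proj₂ (proj₂ extras)) b∈Cs
                            with _ , z∈Zs , _ ← Extra-sound bz
      = inj₂ (z , hung z∈Zs , (λ { refl → Cs∩Zs b∈Cs z∈Zs }) , inj₁ bz)

    forbidden-R : ∀ {b e} → b ∈ˡ R₁ → e ∈ˡ R₁ → Joined F⁺ b e → Joined FE b e × ¬ Joined Extra b e
    forbidden-R b∈ e∈ j = Joined-map ∈-++⁺ˡ (avoidsX b∈ e∈ j) ,
      λ { (inj₁ p) → proj₂ (proj₂ (Extra-sound p)) j
        ; (inj₂ p) → proj₂ (proj₂ (Extra-sound p)) (Joined-sym j) }

    extended : Decomposition (x ∷ y ∷ R₁) (Joined F⁺) (suc q)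
    extended = Extend.extended FE (hypothesis FE R₁-unique R₁-length FE-length)
      x≢y x∉R₁ y∉R₁ {As} {c₀ ∷ X} {X} {Ys} Extra
      As⊆ Bs⊆ X⊆ Ys⊆ (proj₁ split-X) Ys-unique X-length Ys-length
      (λ x∈ a∈ → As-disjoint a∈ (∈-++⁺ˡ x∈)) Ys∩Bs cover (Joined-map (∈-++⁺ʳ F′))
      Joined-sym (λ j → (λ b∈ → As-avoid b∈ j) , (λ b∈ → X-avoid b∈ j)) y-isolated forbidden-R

  -- At most q + 1 pairs have at most 2q + 2 ends, and `R` has 2q + 3 vertices, so some `y` lies on
  -- no pair. If `f` pairs of `F` contain `x`, then with the pair xv at most f + 1 vertices are
  -- forbidden to `x`, and at most q - f pairs avoid `x`.
  oddStep : ∀ q → (∀ {R} F → Unique R → length R ≡ suc (q + q) → length F ≤ q →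
                   Decomposition R (Joined F) q) →
            ∀ {R} x v F → x ∈ˡ R → Unique R → length R ≡ suc (suc q + suc q) → length F ≤ q →
            Decomposition R (Joined ((x , v) ∷ F)) (suc q)
  oddStep q hypothesis {R} x v F x∈R R-unique R-length F-length =
    withIsolated (fresh endpoints R-unique endpoints-length)
    where
    F⁺ : List (A × A)
    F⁺ = (x , v) ∷ F

    endpoints : List A
    endpoints = map proj₁ F⁺ ++ map proj₂ F⁺

    endpoints-length : length endpoints < length R
    endpoints-length = begin-strict
      length endpoints                                  ≡⟨ length-++ (map proj₁ F⁺) ⟩
      length (map proj₁ F⁺) + length (map proj₂ F⁺)     ≡⟨ cong₂ _+_ (length-map proj₁ F⁺) (length-map proj₂ F⁺) ⟩
      length F⁺ + length F⁺                             ≤⟨ ℕ.+-mono-≤ (s≤s F-length) (s≤s F-length) ⟩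
      suc q + suc q                                     <⟨ ℕ.n<1+n _ ⟩
      suc (suc q + suc q)                               ≡⟨ R-length ⟨
      length R                                          ∎
      where open ℕ.≤-Reasoning

    Fˣ F′ : List (A × A)
    Fˣ = filter (touches? x) F
    F′ = filter (¬? ∘ touches? x) F

    f a : ℕ
    f = length Fˣ
    a = q ∸ f

    f+F′ : f + length F′ ≡ length F
    f+F′ = trans (sym (length-++ Fˣ)) (sym (↭-length (filter-↭-++ (touches? x) F)))

    a+f : a + f ≡ q
    a+f = ℕ.m∸n+n≡m (ℕ.≤-trans (ℕ.m+n≤o⇒m≤o f (ℕ.≤-reflexive f+F′)) F-length)

    F′-length : length F′ ≤ a
    F′-length = ℕ.m+n≤o⇒m≤o∸n (length F′) (ℕ.≤-trans (ℕ.≤-reflexive (trans (ℕ.+-comm _ f) f+F′)) F-length)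

    finish : ∀ {y R₀} → (∀ {b} → ¬ Joined F⁺ y b) → R ↭ x ∷ y ∷ R₀ →
             Arrangement R₀ (Joined F⁺ x) a q f → Decomposition R (Joined F⁺) (suc q)
    finish y-isolated R↭xyR₀ arrangement =
      Decomposition-resp (↭-sym R↭) (λ _ _ _ j → j)
        (OddStep.extended F′-length a+f y-isolated arrangement
          (ℕ.suc-injective (ℕ.suc-injective (trans (sym (↭-length R↭))
            (trans R-length (cong (2 +_) (ℕ.+-suc q q))))))
          (Unique-resp-↭ R↭ R-unique) hypothesis)
      where
      R↭ : R ↭ _
      R↭ = ↭-trans R↭xyR₀ (prep _ (prep _ (Arrangement.R↭ arrangement)))

    withRest : ∀ {y R₀} → (∀ {b} → ¬ Joined F⁺ y b) → R ↭ x ∷ y ∷ R₀ → Decomposition R (Joined F⁺) (suc q)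
    withRest {y} {R₀} y-isolated R↭xyR₀ = finish y-isolated R↭xyR₀
      (arrange (joined? F⁺ x) R₀ a q f R₀-length x-neighbours)
      where
      R₀-unique : Unique R₀
      R₀-unique = AllPairs.tail (AllPairs.tail (Unique-resp-↭ R↭xyR₀ R-unique))

      R₀-length : length R₀ ≡ a + (q + suc f)
      R₀-length = ℕ.suc-injective (ℕ.suc-injective (begin
        suc (suc (length R₀))          ≡⟨ ↭-length R↭xyR₀ ⟨
        length R                       ≡⟨ R-length ⟩
        suc (suc q + suc q)            ≡⟨ cong (λ s → suc (suc q + suc s)) a+f ⟨
        suc (suc q + suc (a + f))      ≡⟨ cong (2 +_) (arith q a f) ⟩
        suc (suc (a + (q + suc f)))    ∎))
        where
        open ≡-Reasoning
        arith : ∀ q a f → q + suc (a + f) ≡ a + (q + suc f)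
        arith = solve-∀

      x-neighbours : length (filter (joined? F⁺ x) R₀) ≤ suc f
      x-neighbours = ℕ.≤-trans
        (unique⊆⇒length≤ {ys = map (other x) ((x , v) ∷ Fˣ)} (Uniqueₚ.filter⁺ (joined? F⁺ x) R₀-unique)
          λ b∈ → joined⇒other (touching (proj₂ (∈-filter⁻ (joined? F⁺ x) {xs = R₀} b∈))))
        (ℕ.≤-reflexive (length-map (other x) ((x , v) ∷ Fˣ)))
        where
        touching : ∀ {b} → Joined F⁺ x b → Joined ((x , v) ∷ Fˣ) x b
        touching (inj₁ (here refl)) = inj₁ (here refl)
        touching (inj₁ (there p)) = inj₁ (there (∈-filter⁺ (touches? x) p (inj₁ refl)))
        touching (inj₂ (here refl)) = inj₂ (here refl)
        touching (inj₂ (there p)) = inj₂ (there (∈-filter⁺ (touches? x) p (inj₂ refl)))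

    withIsolated : ∃[ y ] y ∈ˡ R × y ∉ˡ endpoints → Decomposition R (Joined F⁺) (suc q)
    withIsolated (y , y∈R , y∉) =
      -- `x` heads the list of ends, so `y` differs from it.
      withRest y-isolated (proj₂ (removeTwo x∈R y∈R λ { refl → y∉ (here refl) }))
      where
      y-isolated : ∀ {b} → ¬ Joined F⁺ y b
      y-isolated (inj₁ p) = y∉ (∈-++⁺ˡ (∈-map⁺ proj₁ p))
      y-isolated (inj₂ p) = y∉ (∈-++⁺ʳ (map proj₁ F⁺) (∈-map⁺ proj₂ p))

  -- Each step lowers the bound on the pairs by one and the number of vertices by two.
  oddDecomposition : ∀ q {R} F → Unique R → length R ≡ suc (q + q) → length F ≤ q →
                     Decomposition R (Joined F) q
  oddDecomposition zero _ _ _ _ = empty-decomposition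
  oddDecomposition (suc q) F₀ u len F₀-length
    with x , v , F , x∈R , F-length , F₀⇒F ← pointed F₀ (subst (0 <_) (sym len) (s≤s z≤n)) F₀-length
    = Decomposition-resp ↭-refl (λ a∈ b∈ _ → F₀⇒F a∈ b∈)
        (oddStep q (oddDecomposition q) x v F x∈R u len F-length)

-- Edge sets from decidable symmetric relations.

module _ {n} {R : Fin n → Fin n → Set} (R? : ∀ i j → Dec (R i j))
         (R-sym : ∀ {i j} → R i j → R j i) (R-irrefl : ∀ {i} → ¬ R i i) where

  fromRelation : EdgeSet n
  fromRelation = record
    { edge   = λ i j → ⌊ R? i j ⌋
    ; symm   = λ i j → trans (isYes≗does (R? i j))
                 (trans (does-⇔ (mk⇔ R-sym R-sym) (R? i j) (R? j i)) (sym (isYes≗does (R? j i))))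
    ; irrefl = λ i → trans (isYes≗does (R? i i)) (dec-false (R? i i) R-irrefl)
    }

Adj-sym : ∀ {n} (E : EdgeSet n) {i j} → Adj E i j → Adj E j i
Adj-sym E {i} {j} = subst T (EdgeSet.symm E i j)

Adj-irrefl : ∀ {n} (E : EdgeSet n) {i} → ¬ Adj E i i
Adj-irrefl E {i} = subst T (EdgeSet.irrefl E i)

-- Breadth-first parents in a connected subgraph.

ConnectedOn : ∀ {n} {G : Graph n} → Subgraph G → Set
ConnectedOn H = ∀ {i j} → i ∈ V H → j ∈ V H → Star (Adj (E H)) i j

-- A rooted spanning tree given by pointers; the falling `depth` certifies that they lead to `r`.
-- Values at `r` and outside `V H` are unconstrained.
record Parents {n} {G : Graph n} (H : Subgraph G) (r : Fin n) : Set where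
  field
    parent       : Fin n → Fin n
    depth        : Fin n → ℕ
    parent-adj   : ∀ {i} → i ∈ V H → i ≢ r → Adj (E H) i (parent i)
    parent-depth : ∀ {i} → i ∈ V H → i ≢ r → depth (parent i) < depth i

module _ {n} {G : Graph n} (H : Subgraph G) {r} (r∈V : r ∈ V H) (connected : ConnectedOn H) where

  private
    -- The ball of radius `m` about `r`, defined by recursion so as to be decidable.
    Within : ℕ → Fin n → Set
    Within zero    i = i ≡ r
    Within (suc m) i = Within m i ⊎ ∃[ j ] Adj (E H) i j × Within m j

    within? : ∀ m i → Dec (Within m i)
    within? zero    i = i ≟ r
    within? (suc m) i = within? m i ⊎-dec Fin.any? λ j → T? (edge (E H) i j) ×-dec within? m j

    within-mono : ∀ {l m i} → l ≤ m → Within l i → Within m i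
    within-mono {m = zero}  z≤n w = w
    within-mono {l} {suc m} l≤m w with ℕ.m≤n⇒m<n∨m≡n l≤m
    ... | inj₁ (s≤s l≤m′) = inj₁ (within-mono l≤m′ w)
    ... | inj₂ refl = w

    walk⇒within : ∀ {i} → Star (Adj (E H)) i r → ∃[ m ] Within m i
    walk⇒within ε = 0 , refl
    walk⇒within (e ◅ es) with m , w ← walk⇒within es = suc m , inj₂ (_ , e , w)

    Distance : Fin n → ℕ → Set
    Distance i l = Within l i × (∀ {m} → Within m i → l ≤ m)

    least : ∀ m {i} → Within m i → ∃ (Distance i)
    least zero    w = 0 , w , λ _ → z≤n
    least (suc m) {i} w with within? m i
    ... | yes w′ = least m w′
    ... | no ¬w = suc m , w , λ w″ → ℕ.≰⇒> λ l≤m → ¬w (within-mono l≤m w″)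

    distance : ∀ {i} → i ∈ V H → ∃ (Distance i)
    distance i∈ = let m , w = walk⇒within (connected i∈ r∈V) in least m w

    depth : Fin n → ℕ
    depth i with i ∈? V H
    ... | yes i∈ = proj₁ (distance i∈)
    ... | no  _  = 0

    depth-spec : ∀ {i} → i ∈ V H → Distance i (depth i)
    depth-spec {i} i∈ with i ∈? V H
    ... | yes i∈′ = proj₂ (distance i∈′)
    ... | no i∉ = contradiction i∈ i∉

    Closer : Fin n → Fin n → Set
    Closer i j = Adj (E H) i j × depth j < depth i

    -- The first step of a shortest walk to `r`: a vertex at distance `suc m` is not within `m`, so
    -- it lies in the larger ball by way of a neighbour within `m`.
    closer : ∀ {i} → i ∈ V H → i ≢ r → ∃ (Closer i)
    closer {i} i∈ i≢r with depth i | depth-spec i∈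
    ... | zero  | i≡r , _ = contradiction i≡r i≢r
    ... | suc m | inj₁ w , minimal = contradiction (minimal w) ℕ.1+n≰n
    ... | suc m | inj₂ (j , adj , w) , _ =
      j , adj , s≤s (proj₂ (depth-spec (proj₂ (Subgraph.ends∈ H adj))) w)

    -- The decisions are arguments so that `parentBy-closer` can match on them.
    parentBy : ∀ {i} → Dec (i ∈ V H) → Dec (i ≡ r) → Fin n
    parentBy     (yes i∈) (no i≢r) = proj₁ (closer i∈ i≢r)
    parentBy {i} _        _        = i

    parentBy-closer : ∀ {i} (i∈? : Dec (i ∈ V H)) (i≟r : Dec (i ≡ r)) →
                      i ∈ V H → i ≢ r → Closer i (parentBy i∈? i≟r)
    parentBy-closer (yes i∈) (no i≢r)  _  _   = proj₂ (closer i∈ i≢r)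
    parentBy-closer (yes _)  (yes i≡r) _  i≢r = contradiction i≡r i≢r
    parentBy-closer (no i∉)  _         i∈ _   = contradiction i∈ i∉

    parent-closer : ∀ {i} → i ∈ V H → i ≢ r → Closer i (parentBy (i ∈? V H) (i ≟ r))
    parent-closer {i} = parentBy-closer (i ∈? V H) (i ≟ r)

  parents : Parents H r
  parents = record
    { parent       = λ i → parentBy (i ∈? V H) (i ≟ r)
    ; depth        = depth
    ; parent-adj   = λ i∈ i≢r → proj₁ (parent-closer i∈ i≢r)
    ; parent-depth = λ i∈ i≢r → proj₂ (parent-closer i∈ i≢r)
    }

-- Spanning trees from parents, and their acyclicity.

NonBacktracking : ∀ {A : Set} → List A → Set
NonBacktracking (a ∷ b ∷ c ∷ as) = a ≢ c × NonBacktracking (b ∷ c ∷ as)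
NonBacktracking _                = ⊤

unique⇒nonBacktracking : ∀ {A : Set} {s a b : A} as → Unique (a ∷ b ∷ as) → s ∉ˡ a ∷ b ∷ as →
                         NonBacktracking (a ∷ b ∷ as ++ s ∷ [])
unique⇒nonBacktracking []       _ s∉ = (λ { refl → s∉ (here refl) }) , tt
unique⇒nonBacktracking (c ∷ as) ((_ ∷ a≢c ∷ _) ∷ u) s∉ = a≢c , unique⇒nonBacktracking as u (s∉ ∘ there)

module SpanningTree {n} {G : Graph n} (H : Subgraph G) {r} (r∈V : r ∈ V H) (P : Parents H r) where

  open Parents P

  Up : Fin n → Fin n → Set
  Up i j = i ∈ V H × i ≢ r × j ≡ parent i

  up? : ∀ i j → Dec (Up i j)
  up? i j = (i ∈? V H) ×-dec ¬? (i ≟ r) ×-dec (j ≟ parent i)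

  up-adj : ∀ {i j} → Up i j → Adj (E H) i j
  up-adj (i∈ , i≢r , refl) = parent-adj i∈ i≢r

  up-depth : ∀ {i j} → Up i j → depth j < depth i
  up-depth (i∈ , i≢r , refl) = parent-depth i∈ i≢r

  up-unique : ∀ {i j k} → Up i j → Up i k → j ≡ k
  up-unique (_ , _ , refl) (_ , _ , refl) = refl

  TreeAdj : Fin n → Fin n → Set
  TreeAdj i j = Up i j ⊎ Up j i

  treeAdj? : ∀ i j → Dec (TreeAdj i j)
  treeAdj? i j = up? i j ⊎-dec up? j i

  treeEdges : EdgeSet n
  treeEdges = fromRelation treeAdj? swap [ up-irrefl , up-irrefl ]′
    where
    up-irrefl : ∀ {i} → ¬ Up i i
    up-irrefl up = ℕ.<-irrefl refl (up-depth up)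

  treeAdj⁺ : ∀ {i j} → TreeAdj i j → Adj treeEdges i j
  treeAdj⁺ {i} {j} = fromWitness {a? = treeAdj? i j}

  treeAdj⁻ : ∀ {i j} → Adj treeEdges i j → TreeAdj i j
  treeAdj⁻ {i} {j} = toWitness {a? = treeAdj? i j}

  treeEdges⊆ : ∀ {i j} → Adj treeEdges i j → Adj (E H) i j
  treeEdges⊆ = [ up-adj , Adj-sym (E H) ∘ up-adj ]′ ∘ treeAdj⁻

  spanningTree : Subgraph G
  spanningTree = record
    { V = V H ; E = treeEdges
    ; E⊆G = Subgraph.E⊆G H ∘ treeEdges⊆ ; ends∈ = Subgraph.ends∈ H ∘ treeEdges⊆ }

  toRoot : ∀ {i} → Acc _<_ (depth i) → i ∈ V H → Star (Adj treeEdges) i r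
  toRoot {i} (acc rec) i∈ with i ≟ r
  ... | yes refl = ε
  ... | no i≢r = treeAdj⁺ (inj₁ (i∈ , i≢r , refl)) ◅
        toRoot (rec (parent-depth i∈ i≢r)) (proj₂ (Subgraph.ends∈ H (parent-adj i∈ i≢r)))

  -- A walk without backtracking that has once stepped away from the root can
  -- only move further away from it.
  climb : ∀ {s u w} zs → Up w u → Linked (Adj treeEdges) (w ∷ zs ++ s ∷ []) →
          NonBacktracking (u ∷ w ∷ zs ++ s ∷ []) →
          depth u < depth s × ∃[ p ] p ∈ˡ w ∷ zs × Up s p
  climb [] up (e ∷ _) (u≢s , _) with treeAdj⁻ e
  ... | inj₁ up′ = contradiction (up-unique up up′) u≢s
  ... | inj₂ up′ = ℕ.<-trans (up-depth up) (up-depth up′) , _ , here refl , up′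
  climb (z ∷ zs) up (e ∷ es) (u≢z , nb) with treeAdj⁻ e
  ... | inj₁ up′ = contradiction (up-unique up up′) u≢z
  ... | inj₂ up′ with lt , p , p∈ , up″ ← climb zs up′ es nb
      = ℕ.<-trans (up-depth up) lt , p , there p∈ , up″

  -- Either the walk moves towards the root throughout and the depth only falls, or it turns once
  -- and then, by `climb`, enters `s` from the parent of `s`.
  descend : ∀ {s u} zs → Linked (Adj treeEdges) (u ∷ zs ++ s ∷ []) →
            NonBacktracking (u ∷ zs ++ s ∷ []) →
            depth s < depth u ⊎ ∃[ p ] p ∈ˡ u ∷ zs × Up s p
  descend [] (e ∷ _) _ with treeAdj⁻ e
  ... | inj₁ up = inj₁ (up-depth up)
  ... | inj₂ up = inj₂ (_ , here refl , up)
  descend (z ∷ zs) (e ∷ es) nb with treeAdj⁻ e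
  descend (z ∷ zs) (e ∷ es) nb | inj₂ up with _ , p , p∈ , up′ ← climb zs up es nb
    = inj₂ (p , there p∈ , up′)
  descend {s} (z ∷ zs) (e ∷ es) nb | inj₁ up with descend zs es (tail zs nb)
    where
    tail : ∀ zs → NonBacktracking (_ ∷ z ∷ zs ++ s ∷ []) → NonBacktracking (z ∷ zs ++ s ∷ [])
    tail []      (_ , nb) = nb
    tail (_ ∷ _) (_ , nb) = nb
  ... | inj₁ lt = inj₁ (ℕ.<-trans lt (up-depth up))
  ... | inj₂ (p , p∈ , up′) = inj₂ (p , there p∈ , up′)

  -- A cycle that first moves away from the root makes `s` deeper than itself, by `climb`. One that
  -- first moves to the parent `a` of `s` either returns from a parent of `s`, which is again `a`,
  -- against distinctness, or loses depth all the way round.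
  acyclic : ¬ Cycle treeEdges
  acyclic record { rest = [] ; long = () }
  acyclic record { rest = _ ∷ [] ; long = s≤s () }
  acyclic record { start = s ; rest = a ∷ b ∷ zs ; distinct = s∉@(_ ∷ s≢b ∷ _) ∷ u@(a∉ ∷ _) ; closed = e ∷ e′ ∷ es }
    = case (treeAdj⁻ e) (treeAdj⁻ e′)
    where
    nb : NonBacktracking (a ∷ b ∷ zs ++ s ∷ [])
    nb = unique⇒nonBacktracking zs u λ s∈ → All.lookup s∉ s∈ refl
    tail : ∀ zs → NonBacktracking (a ∷ b ∷ zs ++ s ∷ []) → NonBacktracking (b ∷ zs ++ s ∷ [])
    tail []      (_ , nb) = nb
    tail (_ ∷ _) (_ , nb) = nb
    notParent : ∀ {p} → p ∈ˡ b ∷ zs → Up s p → Up s a → ⊥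
    notParent p∈ up up′ with refl ← up-unique up up′ = All.lookup a∉ p∈ refl
    case : TreeAdj s a → TreeAdj a b → ⊥
    case (inj₂ up) _ = ℕ.<-irrefl refl (proj₁ (climb (b ∷ zs) up (e′ ∷ es) (s≢b , nb)))
    case (inj₁ up) (inj₂ up′) with _ , p , p∈ , up″ ← climb zs up′ es nb = notParent p∈ up″ up
    case (inj₁ up) (inj₁ up′) with descend zs es (tail zs nb)
    ... | inj₁ lt = ℕ.<-asym lt (ℕ.<-trans (up-depth up′) (up-depth up))
    ... | inj₂ (p , p∈ , up″) = notParent p∈ up″ up

  isTree : IsTree spanningTree
  isTree = record
    { nonempty  = r , r∈V
    ; connected = λ i∈ j∈ → toRoot (<-wellFounded _) i∈ ◅◅ reverse (Adj-sym treeEdges) (toRoot (<-wellFounded _) j∈)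
    ; acyclic   = acyclic }

-- Subsets as lists, and trees from connected subgraphs.

open Decompose using (Decomposition; module Decomposition; Link)

elements : ∀ {n} → Subset n → List (Fin n)
elements []          = []
elements (true ∷ S)  = zero ∷ map suc (elements S)
elements (false ∷ S) = map suc (elements S)

elements⁺ : ∀ {n} {S : Subset n} {i} → i ∈ S → i ∈ˡ elements S
elements⁺ here = here refl
elements⁺ {S = true  ∷ S} (there i∈) = there (∈-map⁺ suc (elements⁺ i∈))
elements⁺ {S = false ∷ S} (there i∈) = ∈-map⁺ suc (elements⁺ i∈)

elements⁻ : ∀ {n} {S : Subset n} {i} → i ∈ˡ elements S → i ∈ S
elements⁻ {S = true ∷ S} (here refl) = here
elements⁻ {S = true ∷ S} (there i∈) with _ , j∈ , refl ← ∈-map⁻ suc i∈ = there (elements⁻ j∈)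
elements⁻ {S = false ∷ S} i∈ with _ , j∈ , refl ← ∈-map⁻ suc i∈ = there (elements⁻ j∈)

elements-unique : ∀ {n} (S : Subset n) → Unique (elements S)
elements-unique [] = []
elements-unique (true ∷ S) =
  All.tabulate (λ { i∈ refl → case (∈-map⁻ suc i∈) }) ∷ Uniqueₚ.map⁺ Fin.suc-injective (elements-unique S)
  where
  case : ∃[ j ] j ∈ˡ elements S × zero ≡ suc j → ⊥
  case (_ , _ , ())
elements-unique (false ∷ S) = Uniqueₚ.map⁺ Fin.suc-injective (elements-unique S)

elements-length : ∀ {n} (S : Subset n) → length (elements S) ≡ ∣ S ∣
elements-length [] = refl
elements-length (true ∷ S) = cong suc (trans (length-map suc (elements S)) (elements-length S))
elements-length (false ∷ S) = trans (length-map suc (elements S)) (elements-length S)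

lookup-injective : ∀ {A : Set} {xs : List A} → Unique xs → ∀ {i j} → lookup xs i ≡ lookup xs j → i ≡ j
lookup-injective (_ ∷ _)  {zero}  {zero}  _  = refl
lookup-injective (x≢ ∷ _) {zero}  {suc j} eq = contradiction eq (All.lookup x≢ (∈-lookup j))
lookup-injective (x≢ ∷ _) {suc i} {zero}  eq = contradiction (sym eq) (All.lookup x≢ (∈-lookup i))
lookup-injective (_ ∷ u)  {suc i} {suc j} eq = cong suc (lookup-injective u eq)

adj? : ∀ {n} (G : Graph n) i j → Dec (Adj G i j)
adj? G i j = T? (edge G i j)

-- A spanning tree keeps the vertex set and takes some of the edges, so both disjointness conditions
-- pass from the subgraphs to the trees.
treesFromSubgraphs :
  ∀ {n m} {G : Graph n} {S : Subset n} (H : Fin m → Subgraph G) →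
  (∀ t → ConnectedOn (H t)) → (∀ t → Nonempty (V (H t))) → (∀ t → S ⊆ V (H t)) →
  (∀ s t → s ≢ t → (∀ {i j} → Adj (E (H s)) i j → ¬ Adj (E (H t)) i j) × V (H s) ∩ V (H t) ≡ S) →
  DisjointTrees G S m
treesFromSubgraphs H connected nonempty S⊆V disjoint =
  (λ t → record { tree = SpanningTree.spanningTree (H t) (proj₂ (nonempty t)) (P t)
                ; isTree = SpanningTree.isTree (H t) (proj₂ (nonempty t)) (P t)
                ; S⊆V = S⊆V t }) ,
  λ s t s≢t → (λ i j e e′ → proj₁ (disjoint s t s≢t) (below s e) (below t e′)) , proj₂ (disjoint s t s≢t)
  where
  P : ∀ t → Parents (H t) (proj₁ (nonempty t))
  P t = parents (H t) (proj₂ (nonempty t)) (connected t)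
  below : ∀ t {i j} → Adj (SpanningTree.treeEdges (H t) (proj₂ (nonempty t)) (P t)) i j → Adj (E (H t)) i j
  below t = SpanningTree.treeEdges⊆ (H t) (proj₂ (nonempty t)) (P t)

-- Colour classes and stars as a disjoint family.

SameEdge : ∀ {A : Set} → A → A → A → A → Set
SameEdge a b c d = (a ≡ c × b ≡ d) ⊎ (a ≡ d × b ≡ c)

SameEdge-sym : ∀ {A : Set} {a b c d : A} → SameEdge a b c d → SameEdge c d a b
SameEdge-sym (inj₁ (refl , refl)) = inj₁ (refl , refl)
SameEdge-sym (inj₂ (refl , refl)) = inj₂ (refl , refl)

-- A triple (w , s , s′) of Z records that the non-edge ws is bypassed by the
-- path w s′ s; F contains the edges ss′ used up in this way.
record Detours {n} (G : Graph n) (S : Subset n)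
               (Z : List (Fin n × Fin n × Fin n)) (F : List (Fin n × Fin n)) : Set where
  field
    inner    : ∀ {w s s′} → (w , s , s′) ∈ˡ Z → s ∈ S × s′ ∈ S
    path     : ∀ {w s s′} → (w , s , s′) ∈ˡ Z → Adj G w s′ × Adj G s s′
    used     : ∀ {w s s′} → (w , s , s′) ∈ˡ Z → Joined F s s′
    separate : ∀ {w s s′ v t t′} → (w , s , s′) ∈ˡ Z → (v , t , t′) ∈ˡ Z → w ≢ v →
               ¬ SameEdge s s′ t t′

module _ {n} {G : Graph n} {S : Subset n} {Z F} (detours : Detours G S Z F)
         (missing-inner : ∀ {i j} → i ∈ S → j ∈ S → i ≢ j → ¬ Adj G i j → Joined F i j)
         (missing-outer : ∀ {w s} → w ∉ S → s ∈ S → ¬ Adj G w s → ∃[ s′ ] (w , s , s′) ∈ˡ Z)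
         {q} (D : Decomposition _≟_ (elements S) (Joined F) q) (S-nonempty : Nonempty S)
         where

  open Detours detours
  private
    module D = Decomposition D
    open DecMembership (_≟_ {n}) using () renaming (_∈?_ to _∈ˡ?_)
    open DecMembership (≡-dec (_≟_ {n}) (≡-dec (_≟_ {n}) (_≟_ {n}))) using () renaming (_∈?_ to _∈Z?_)

    ClassLink : Fin q → Fin n → Fin n → Set
    ClassLink t = Link _≟_ (elements S) D.colour (toℕ t)

    classLink? : ∀ t i j → Dec (ClassLink t i j)
    classLink? t i j = (i ∈ˡ? elements S) ×-dec (j ∈ˡ? elements S) ×-dec ¬? (i ≟ j) ×-dec (D.colour i j ℕ.≟ toℕ t)

    classEdges : Fin q → EdgeSet n
    classEdges t = fromRelation (classLink? t)
      (λ (i∈ , j∈ , i≢j , eq) → j∈ , i∈ , i≢j ∘ sym , trans (D.colour-sym _ _) eq)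
      (λ (_ , _ , i≢i , _) → i≢i refl)

    classEdge⁻ : ∀ t {i j} → Adj (classEdges t) i j → ClassLink t i j
    classEdge⁻ t {i} {j} = toWitness {a? = classLink? t i j}

    classEdge-used : ∀ t {i j} → Adj (classEdges t) i j → ¬ Joined F i j
    classEdge-used t {i} {j} e f with i∈ , j∈ , i≢j , eq ← classEdge⁻ t e
      = ℕ.<⇒≱ (Fin.toℕ<n t) (subst (q ≤_) eq (D.avoids i∈ j∈ i≢j f))

    class : Fin q → Subgraph G
    class t = record
      { V = S ; E = classEdges t
      -- A non-edge of `G` inside `S` is joined in `F`, which the classes avoid.
      ; E⊆G = λ {i} {j} e → decidable-stable (adj? G i j) λ ¬adj →
          let i∈ , j∈ , i≢j , _ = classEdge⁻ t e in
          classEdge-used t e (missing-inner (elements⁻ i∈) (elements⁻ j∈) i≢j ¬adj)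
      ; ends∈ = λ e → let i∈ , j∈ , _ = classEdge⁻ t e in elements⁻ i∈ , elements⁻ j∈ }

    class-connected : ∀ t → ConnectedOn (class t)
    class-connected t i∈ j∈ = mapStar (λ {i} {j} → fromWitness {a? = classLink? t i j})
      (D.connected (Fin.toℕ<n t) (elements⁺ i∈) (elements⁺ j∈))

    -- The directed edges of the star at `w`: from `w` to its neighbours in `S`, and from a
    -- non-neighbour `s` to the middle vertex `s′` of its detour.
    Spoke : Fin n → Fin n → Fin n → Set
    Spoke w i j = (i ≡ w × j ∈ S × Adj G w j) ⊎ (w , i , j) ∈ˡ Z

    spoke? : ∀ w i j → Dec (Spoke w i j)
    spoke? w i j = ((i ≟ w) ×-dec (j ∈? S) ×-dec adj? G w j) ⊎-dec ((w , i , j) ∈Z? Z)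

    StarLink : Fin n → Fin n → Fin n → Set
    StarLink w i j = Spoke w i j ⊎ Spoke w j i

    starLink? : ∀ w i j → Dec (StarLink w i j)
    starLink? w i j = spoke? w i j ⊎-dec spoke? w j i

    spoke-adj : ∀ {w i j} → Spoke w i j → Adj G i j
    spoke-adj (inj₁ (refl , _ , adj)) = adj
    spoke-adj (inj₂ z) = proj₂ (path z)

    starEdges : Fin n → EdgeSet n
    starEdges w = fromRelation (starLink? w) swap [ Adj-irrefl G ∘ spoke-adj , Adj-irrefl G ∘ spoke-adj ]′

    starEdge⁻ : ∀ w {i j} → Adj (starEdges w) i j → StarLink w i j
    starEdge⁻ w {i} {j} = toWitness {a? = starLink? w i j}

    starEdge⁺ : ∀ w {i j} → StarLink w i j → Adj (starEdges w) i j
    starEdge⁺ w {i} {j} = fromWitness {a? = starLink? w i j}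

    S⊆star : ∀ w → S ⊆ S ∪ ⁅ w ⁆
    S⊆star w = p⊆p∪q ⁅ w ⁆

    w∈star : ∀ w → w ∈ S ∪ ⁅ w ⁆
    w∈star w = x∈p∪q⁺ (inj₂ (x∈⁅x⁆ w))

    spoke-ends : ∀ {w i j} → Spoke w i j → i ∈ S ∪ ⁅ w ⁆ × j ∈ S ∪ ⁅ w ⁆
    spoke-ends {w} (inj₁ (refl , j∈ , _)) = w∈star w , S⊆star w j∈
    spoke-ends {w} (inj₂ z) = S⊆star w (proj₁ (inner z)) , S⊆star w (proj₂ (inner z))

    star : Fin n → Subgraph G
    star w = record
      { V = S ∪ ⁅ w ⁆ ; E = starEdges w
      ; E⊆G = [ spoke-adj , Adj-sym G ∘ spoke-adj ]′ ∘ starEdge⁻ w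
      ; ends∈ = [ spoke-ends , (λ (j∈ , i∈) → i∈ , j∈) ∘ spoke-ends ]′ ∘ starEdge⁻ w }

    star-connected : ∀ {w} → w ∉ S → ConnectedOn (star w)
    star-connected {w} w∉ i∈ j∈ = toCentre i∈ ◅◅ reverse (Adj-sym (starEdges w)) (toCentre j∈)
      where
      toCentre : ∀ {i} → i ∈ S ∪ ⁅ w ⁆ → Star (Adj (starEdges w)) i w
      toCentre {i} i∈ with x∈p∪q⁻ S ⁅ w ⁆ i∈
      ... | inj₂ i∈w with refl ← x∈⁅y⁆⇒x≡y w i∈w = ε
      ... | inj₁ i∈S with adj? G w i
      ... | yes adj = return (starEdge⁺ w (inj₂ (inj₁ (refl , i∈S , adj))))
      ... | no ¬adj with s′ , z ← missing-outer w∉ i∈S ¬adj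
        = starEdge⁺ w (inj₁ (inj₂ z)) ◅
          return (starEdge⁺ w (inj₂ (inj₁ (refl , proj₂ (inner z) , proj₁ (path z)))))

    class∩class : ∀ {s t} → s ≢ t → ∀ {i j} → Adj (classEdges s) i j → ¬ Adj (classEdges t) i j
    class∩class {s} {t} s≢t e e′ with _ , _ , _ , eq ← classEdge⁻ s e | _ , _ , _ , eq′ ← classEdge⁻ t e′
      = s≢t (Fin.toℕ-injective (trans (sym eq) eq′))

    -- A star edge contains `w`, which lies outside `S`, or is a detour edge, which `F` withholds
    -- from the classes.
    class∩star : ∀ t {w} → w ∉ S → ∀ {i j} → Adj (classEdges t) i j → ¬ Adj (starEdges w) i j
    class∩star t {w} w∉ e e′ with i∈ , j∈ , _ ← classEdge⁻ t e | starEdge⁻ w e′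
    ... | inj₁ (inj₁ (refl , _)) = w∉ (elements⁻ i∈)
    ... | inj₁ (inj₂ z)          = classEdge-used t e (used z)
    ... | inj₂ (inj₁ (refl , _)) = w∉ (elements⁻ j∈)
    ... | inj₂ (inj₂ z)          = classEdge-used t e (Joined-sym (used z))

    -- Edges at the centres differ because the centres are distinct and lie outside `S`; detour
    -- edges differ by `separate`.
    spoke∩spoke : ∀ {v w} → v ∉ S → w ∉ S → v ≢ w → ∀ {i j} → Spoke v i j → ¬ Spoke w i j
    spoke∩spoke v∉ w∉ v≢w (inj₁ (refl , _)) (inj₁ (refl , _)) = v≢w refl
    spoke∩spoke v∉ w∉ v≢w (inj₁ (refl , _)) (inj₂ z) = v∉ (proj₁ (inner z))
    spoke∩spoke v∉ w∉ v≢w (inj₂ z) (inj₁ (refl , _)) = w∉ (proj₁ (inner z))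
    spoke∩spoke v∉ w∉ v≢w (inj₂ z) (inj₂ z′) = separate z z′ v≢w (inj₁ (refl , refl))

    spoke∩spokeʳ : ∀ {v w} → v ∉ S → w ∉ S → v ≢ w → ∀ {i j} → Spoke v i j → ¬ Spoke w j i
    spoke∩spokeʳ v∉ w∉ v≢w (inj₁ (refl , _)) (inj₁ (_ , v∈ , _)) = v∉ v∈
    spoke∩spokeʳ v∉ w∉ v≢w (inj₁ (refl , _)) (inj₂ z) = v∉ (proj₂ (inner z))
    spoke∩spokeʳ v∉ w∉ v≢w (inj₂ z) (inj₁ (refl , _)) = w∉ (proj₂ (inner z))
    spoke∩spokeʳ v∉ w∉ v≢w (inj₂ z) (inj₂ z′) = separate z z′ v≢w (inj₂ (refl , refl))

    star∩star : ∀ {v w} → v ∉ S → w ∉ S → v ≢ w → ∀ {i j} → Adj (starEdges v) i j → ¬ Adj (starEdges w) i j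
    star∩star {v} {w} v∉ w∉ v≢w e e′ with starEdge⁻ v e | starEdge⁻ w e′
    ... | inj₁ p | inj₁ p′ = spoke∩spoke v∉ w∉ v≢w p p′
    ... | inj₁ p | inj₂ p′ = spoke∩spokeʳ v∉ w∉ v≢w p p′
    ... | inj₂ p | inj₁ p′ = spoke∩spokeʳ v∉ w∉ v≢w p p′
    ... | inj₂ p | inj₂ p′ = spoke∩spoke v∉ w∉ v≢w p p′

    ∩≡S : ∀ {A B : Subset n} → S ⊆ A → S ⊆ B → (∀ {i} → i ∈ A → i ∈ B → i ∈ S) → A ∩ B ≡ S
    ∩≡S {A} {B} S⊆A S⊆B ∩⊆S = ⊆-antisym
      (λ i∈ → let i∈A , i∈B = x∈p∩q⁻ A B i∈ in ∩⊆S i∈A i∈B) (λ i∈ → x∈p∩q⁺ (S⊆A i∈ , S⊆B i∈))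

    Ws : List (Fin n)
    Ws = elements (∁ S)

    w∉S : ∀ (a : Fin (length Ws)) → lookup Ws a ∉ S
    w∉S a = x∈∁p⇒x∉p (elements⁻ (∈-lookup a))

    Index : Set
    Index = Fin q ⊎ Fin (length Ws)

    member : Index → Subgraph G
    member = [ class , star ∘ lookup Ws ]′

    S⊆member : ∀ a → S ⊆ V (member a)
    S⊆member (inj₁ _) = ⊆-refl
    S⊆member (inj₂ a) = S⊆star _

    disjoint : ∀ a b → a ≢ b → (∀ {i j} → Adj (E (member a)) i j → ¬ Adj (E (member b)) i j) ×
                               V (member a) ∩ V (member b) ≡ S
    disjoint (inj₁ s) (inj₁ t) a≢b =
      class∩class (a≢b ∘ cong inj₁) , ∩≡S ⊆-refl ⊆-refl (λ i∈ _ → i∈)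
    disjoint (inj₁ s) (inj₂ b) _ =
      class∩star s (w∉S b) , ∩≡S ⊆-refl (S⊆star _) (λ i∈ _ → i∈)
    disjoint (inj₂ a) (inj₁ t) _ =
      (λ e e′ → class∩star t (w∉S a) e′ e) , ∩≡S (S⊆star _) ⊆-refl (λ _ i∈ → i∈)
    disjoint (inj₂ a) (inj₂ b) a≢b =
      star∩star (w∉S a) (w∉S b) w≢w′ , ∩≡S (S⊆star _) (S⊆star _) both
      where
      w≢w′ : lookup Ws a ≢ lookup Ws b
      w≢w′ eq = a≢b (cong inj₂ (lookup-injective (elements-unique (∁ S)) eq))
      both : ∀ {i} → i ∈ S ∪ ⁅ lookup Ws a ⁆ → i ∈ S ∪ ⁅ lookup Ws b ⁆ → i ∈ S
      both i∈a i∈b with x∈p∪q⁻ S _ i∈a | x∈p∪q⁻ S _ i∈b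
      ... | inj₁ i∈S | _ = i∈S
      ... | inj₂ _ | inj₁ i∈S = i∈S
      ... | inj₂ p | inj₂ p′ = contradiction (trans (sym (x∈⁅y⁆⇒x≡y _ p)) (x∈⁅y⁆⇒x≡y _ p′)) w≢w′

    member-connected : ∀ a → ConnectedOn (member a)
    member-connected (inj₁ t) = class-connected t
    member-connected (inj₂ a) = star-connected (w∉S a)

  -- One tree for each colour class and one star for each vertex outside `S`.
  disjointTrees : DisjointTrees G S (q + (n ∸ ∣ S ∣))
  disjointTrees = subst (λ l → DisjointTrees G S (q + l)) (trans (elements-length (∁ S)) (∣∁p∣≡n∸∣p∣ S))
    (treesFromSubgraphs (λ t → member (splitAt q t)) (λ t → member-connected (splitAt q t))
      (λ t → let i , i∈ = S-nonempty in i , S⊆member (splitAt q t) i∈)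
      (λ t → S⊆member (splitAt q t))
      (λ s t s≢t → disjoint (splitAt q s) (splitAt q t)
        λ eq → s≢t (trans (sym (Fin.join-splitAt q _ s)) (trans (cong (join q _) eq) (Fin.join-splitAt q _ t)))))

-- Detours around missing edges.

module _ {n} (G : Graph n) (S : Subset n) (Ms : List (Fin n × Fin n))
         (missing : ∀ {i j} → i ≢ j → ¬ Adj G i j → Joined Ms i j)
         (few : length Ms + length Ms < ∣ S ∣) where

  open Decompose (_≟_ {n}) using (fresh; other; joined⇒other)

  private
    -- The one candidate for `s′` that a missing pair can rule out: its other end, if it contains
    -- `w` or `s`. One value per pair keeps the count at `length Ms`, although both ws′ and ss′ have
    -- to be edges.
    otherEnd : Fin n → Fin n → Fin n × Fin n → Fin n
    otherEnd w s (u , v) with u ≟ w | u ≟ s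
    ... | no _ | no _ = u
    ... | _    | _    = v

    otherEnd-first : ∀ w s v → otherEnd w s (w , v) ≡ v
    otherEnd-first w s v with w ≟ w | w ≟ s
    ... | yes _ | _     = refl
    ... | no ≢  | _     = contradiction refl ≢

    otherEnd-second : ∀ w s v → otherEnd w s (s , v) ≡ v
    otherEnd-second w s v with s ≟ w | s ≟ s
    ... | yes _ | _     = refl
    ... | no _  | yes _ = refl
    ... | no _  | no ≢  = contradiction refl ≢

    otherEnd-neither : ∀ {w s u} v → u ≢ w → u ≢ s → otherEnd w s (u , v) ≡ u
    otherEnd-neither {w} {s} {u} v u≢w u≢s with u ≟ w | u ≟ s
    ... | yes u≡w | _       = contradiction u≡w u≢w
    ... | no _    | yes u≡s = contradiction u≡s u≢s
    ... | no _    | no _    = refl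

    -- The choices of `s′` to be avoided: `s`, the ends of missing pairs, and the vertices whose
    -- edge to `s` is already withdrawn. If `F` is shorter than `Ms`, these are at most twice
    -- `length Ms`, fewer than the vertices of `S`.
    excluded : Fin n → Fin n → List (Fin n × Fin n) → List (Fin n)
    excluded w s F = s ∷ map (otherEnd w s) Ms ++ map (other s) F

    excluded-length : ∀ w s F → length F < length Ms → length (excluded w s F) < length (elements S)
    excluded-length w s F F<Ms = begin-strict
      suc (length (map (otherEnd w s) Ms ++ map (other s) F)) ≡⟨ cong suc (length-++ (map (otherEnd w s) Ms)) ⟩
      suc (length (map (otherEnd w s) Ms) + length (map (other s) F))
        ≡⟨ cong suc (cong₂ _+_ (length-map (otherEnd w s) Ms) (length-map (other s) F)) ⟩
      suc (length Ms + length F)   ≡⟨ ℕ.+-suc (length Ms) (length F) ⟨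
      length Ms + suc (length F)   ≤⟨ ℕ.+-monoʳ-≤ (length Ms) F<Ms ⟩
      length Ms + length Ms        <⟨ few ⟩
      ∣ S ∣                        ≡⟨ elements-length S ⟨
      length (elements S)          ∎
      where open ℕ.≤-Reasoning

    reroute : ∀ {w s} F → length F < length Ms → w ∉ S → s ∈ S →
              ∃[ s′ ] s′ ∈ S × Adj G w s′ × Adj G s s′ × ¬ Joined F s s′
    reroute {w} {s} F F<Ms w∉ s∈
      with t , t∈ , t∉ ← fresh (excluded w s F) (elements-unique S) (excluded-length w s F F<Ms)
      = t , elements⁻ t∈ ,
        decidable-stable (adj? G w t) (λ ¬adj → t∉Ms (listed-w (missing (t≢w ∘ sym) ¬adj))) ,
        decidable-stable (adj? G s t) (λ ¬adj → t∉Ms (listed-s (missing (t≢s ∘ sym) ¬adj))) ,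
        λ j → t∉ (there (∈-++⁺ʳ (map (otherEnd w s) Ms) (joined⇒other j)))
      where
      t≢s : t ≢ s
      t≢s t≡s = t∉ (here t≡s)
      t≢w : t ≢ w
      t≢w refl = w∉ (elements⁻ t∈)
      t∉Ms : t ∉ˡ map (otherEnd w s) Ms
      t∉Ms t∈Ms = t∉ (there (∈-++⁺ˡ t∈Ms))
      listed : ∀ {e} → e ∈ˡ Ms → otherEnd w s e ≡ t → t ∈ˡ map (otherEnd w s) Ms
      listed e∈ eq = subst (_∈ˡ _) eq (∈-map⁺ (otherEnd w s) e∈)
      listed-w : Joined Ms w t → t ∈ˡ map (otherEnd w s) Ms
      listed-w (inj₁ e∈) = listed e∈ (otherEnd-first w s t)
      listed-w (inj₂ e∈) = listed e∈ (otherEnd-neither w t≢w t≢s)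
      listed-s : Joined Ms s t → t ∈ˡ map (otherEnd w s) Ms
      listed-s (inj₁ e∈) = listed e∈ (otherEnd-second w s t)
      listed-s (inj₂ e∈) = listed e∈ (otherEnd-neither s t≢w t≢s)

    -- The state after treating the missing pairs in `L`, with at most one withdrawn edge for each
    -- of them.
    Found : List (Fin n × Fin n) → Set
    Found L = ∃[ Z ] ∃[ F ] Detours G S Z F × length F ≤ length L ×
      (∀ {i j} → (i , j) ∈ˡ L → i ∈ S → j ∈ S → (i , j) ∈ˡ F) ×
      (∀ {w s} → Joined L w s → w ∉ S → s ∈ S → ∃[ s′ ] (w , s , s′) ∈ˡ Z)

    -- All earlier detour edges are joined in `F`, and `reroute` picks an edge that is not, so the
    -- detours stay separate.
    addDetour : ∀ {L w s} → Found L → length L < length Ms →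
                w ∉ S → s ∈ S →
                ∃[ Z ] ∃[ F ] Detours G S Z F × length F ≤ suc (length L) ×
                (∀ {i j} → (i , j) ∈ˡ L → i ∈ S → j ∈ S → (i , j) ∈ˡ F) ×
                (∀ {v t} → Joined ((w , s) ∷ L) v t → v ∉ S → t ∈ S → ∃[ s′ ] (v , t , s′) ∈ˡ Z)
    addDetour {L} {w} {s} (Z , F , D , F-length , inner′ , outer′) L<Ms w∉ s∈
      with t , t∈ , wt , st , free ← reroute F (ℕ.≤-<-trans F-length L<Ms) w∉ s∈
      = (w , s , t) ∷ Z , (s , t) ∷ F , detours , s≤s F-length , (λ e∈ i∈ j∈ → there (inner′ e∈ i∈ j∈)) ,
        λ { (inj₁ (here refl)) _ _ → t , here refl
          ; (inj₁ (there e∈)) v∉ u∈ → let s′ , z = outer′ (inj₁ e∈) v∉ u∈ in s′ , there z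
          ; (inj₂ (here refl)) v∉ _ → contradiction s∈ v∉
          ; (inj₂ (there e∈)) v∉ u∈ → let s′ , z = outer′ (inj₂ e∈) v∉ u∈ in s′ , there z }
      where
      open Detours D
      unused : ∀ {v u u′} → (v , u , u′) ∈ˡ Z → ¬ SameEdge s t u u′
      unused z (inj₁ (refl , refl)) = free (used z)
      unused z (inj₂ (refl , refl)) = free (Joined-sym (used z))
      detours : Detours G S ((w , s , t) ∷ Z) ((s , t) ∷ F)
      detours = record
        { inner = λ { (here refl) → s∈ , t∈ ; (there z) → inner z }
        ; path = λ { (here refl) → wt , st ; (there z) → path z }
        ; used = λ { (here refl) → inj₁ (here refl) ; (there z) → Joined-map there (used z) }
        ; separate = λ { (here refl) (here refl) w≢w _ → w≢w refl
                       ; (here refl) (there z) _ same → unused z same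
                       ; (there z) (here refl) _ same → unused z (SameEdge-sym same)
                       ; (there z) (there z′) → separate z z′ } }

    -- By the number of ends in `S`: with two, the pair itself goes into `F`; with one, a detour
    -- edge does; with none, nothing does.
    find : ∀ L → length L ≤ length Ms → Found L
    find [] _ = [] , [] , record { inner = λ () ; path = λ () ; used = λ () ; separate = λ () } ,
      z≤n , (λ ()) , λ { (inj₁ ()) ; (inj₂ ()) }
    find ((i , j) ∷ L) L<Ms with find L (ℕ.<⇒≤ L<Ms) | i ∈? S | j ∈? S
    ... | Z , F , D , F-length , inner′ , outer′ | yes i∈ | yes j∈ =
      Z , (i , j) ∷ F ,
      record { inner = inner ; path = path ; used = Joined-map there ∘ used ; separate = separate } ,
      s≤s F-length , (λ { (here refl) _ _ → here refl ; (there e∈) a∈ b∈ → there (inner′ e∈ a∈ b∈) }) ,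
      λ { (inj₁ (here refl)) i∉ _ → contradiction i∈ i∉ ; (inj₁ (there e∈)) → outer′ (inj₁ e∈)
        ; (inj₂ (here refl)) j∉ _ → contradiction j∈ j∉ ; (inj₂ (there e∈)) → outer′ (inj₂ e∈) }
      where open Detours D
    ... | found | no i∉ | yes j∈ with Z , F , D , F-length , inner′ , outer′ ← addDetour found L<Ms i∉ j∈ =
      Z , F , D , F-length ,
      (λ { (here refl) i∈ _ → contradiction i∈ i∉ ; (there e∈) → inner′ e∈ }) , outer′
    -- The vertex outside `S` comes second here, so the two orientations are exchanged at the end.
    ... | found | yes i∈ | no j∉ with Z , F , D , F-length , inner′ , outer′ ← addDetour found L<Ms j∉ i∈ =
      Z , F , D , F-length ,
      (λ { (here refl) _ j∈ → contradiction j∈ j∉ ; (there e∈) → inner′ e∈ }) ,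
      λ { (inj₁ (here refl)) → outer′ (inj₂ (here refl)) ; (inj₁ (there e∈)) → outer′ (inj₁ (there e∈))
        ; (inj₂ (here refl)) → outer′ (inj₁ (here refl)) ; (inj₂ (there e∈)) → outer′ (inj₂ (there e∈)) }
    ... | Z , F , D , F-length , inner′ , outer′ | no i∉ | no j∉ =
      Z , F , D , ℕ.m≤n⇒m≤1+n F-length ,
      (λ { (here refl) i∈ _ → contradiction i∈ i∉ ; (there e∈) → inner′ e∈ }) ,
      λ { (inj₁ (here refl)) _ j∈ → contradiction j∈ j∉ ; (inj₁ (there e∈)) → outer′ (inj₁ e∈)
        ; (inj₂ (here refl)) _ i∈ → contradiction i∈ i∉ ; (inj₂ (there e∈)) → outer′ (inj₂ e∈) }

  disjointTrees-missing : ∀ {q} → Nonempty S →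
    (∀ {F} → length F ≤ length Ms → Decomposition _≟_ (elements S) (Joined F) q) →
    DisjointTrees G S (q + (n ∸ ∣ S ∣))
  disjointTrees-missing S-nonempty decompose
    with Z , F , D , F-length , inner′ , outer′ ← find Ms ℕ.≤-refl
    = disjointTrees D
        (λ i∈ j∈ i≢j ¬adj → [ (λ e∈ → inj₁ (inner′ e∈ i∈ j∈)) , (λ e∈ → inj₂ (inner′ e∈ j∈ i∈)) ]′ (missing i≢j ¬adj))
        (λ w∉ s∈ ¬adj → outer′ (missing (λ { refl → w∉ s∈ }) ¬adj) w∉ s∈)
        (decompose F-length) S-nonempty

-- Counting by sums of indicators.

#_ : Dec Φ → ℕ
# d = if does d then 1 else 0

infix 8 #_

#-mono : (Φ → Ψ) → (p? : Dec Φ) (q? : Dec Ψ) → # p? ≤ # q?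
#-mono f (no _)  q?      = z≤n
#-mono f (yes p) (yes _) = ℕ.≤-refl
#-mono f (yes p) (no ¬q) = contradiction (f p) ¬q

#-disjoint : (Φ → Ω) → (Ψ → Ω) → (Φ → Ψ → ⊥) → (p? : Dec Φ) (q? : Dec Ψ) (r? : Dec Ω) →
             # p? + # q? ≤ # r?
#-disjoint f g h (yes p) (yes q) r? = ⊥-elim (h p q)
#-disjoint f g h (yes p) (no _)  r? = #-mono f (yes p) r?
#-disjoint f g h (no _)  q?      r? = #-mono g q? r?

#-cover : (Φ → Ψ ⊎ Ω) → (p? : Dec Φ) (q? : Dec Ψ) (r? : Dec Ω) → # p? ≤ # q? + # r?
#-cover f (no _) q? r? = z≤n
#-cover f (yes p) q? r? with f p
... | inj₁ q = ℕ.≤-trans (#-mono (λ _ → q) (yes p) q?) (ℕ.m≤m+n _ _)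
... | inj₂ r = ℕ.≤-trans (#-mono (λ _ → r) (yes p) r?) (ℕ.m≤n+m _ _)

#-× : (p? : Dec Φ) (q? : Dec Ψ) → # (p? ×-dec q?) ≡ # p? * # q?
#-× (yes _) q? = sym (ℕ.+-identityʳ _)
#-× (no _)  q? = refl

#-¬ : (p? : Dec Φ) → # p? + # (¬? p?) ≡ 1
#-¬ (yes _) = refl
#-¬ (no _)  = refl

sum-mono : ∀ {n} {f g : Fin n → ℕ} → (∀ i → f i ≤ g i) → sum f ≤ sum g
sum-mono {zero}  f≤g = z≤n
sum-mono {suc n} f≤g = ℕ.+-mono-≤ (f≤g zero) (sum-mono (f≤g ∘ suc))

sum-const : ∀ n c → sum {n} (λ _ → c) ≡ n * c
sum-const zero    c = refl
sum-const (suc n) c = cong (c +_) (sum-const n c)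

term≤sum : ∀ {n} (f : Fin n → ℕ) i → f i ≤ sum f
term≤sum f zero    = ℕ.m≤m+n _ _
term≤sum f (suc i) = ℕ.≤-trans (term≤sum (f ∘ suc) i) (ℕ.m≤n+m _ _)

#≤sum : ∀ {n} {B : Fin n → Set} (b? : ∀ t → Dec (B t)) (p? : Dec Φ) → (Φ → ∃ B) → # p? ≤ sum (λ t → # (b? t))
#≤sum b? (no _) f = z≤n
#≤sum b? (yes p) f with t , b ← f p = ℕ.≤-trans (#-mono (λ _ → b) (yes p) (b? t)) (term≤sum (λ t → # (b? t)) t)

sum≤# : ∀ {n} {B : Fin n → Set} (b? : ∀ t → Dec (B t)) (p? : Dec Φ) →
        (∀ {s t} → s ≢ t → B s → B t → ⊥) → (∀ {t} → B t → Φ) → sum (λ t → # (b? t)) ≤ # p?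
sum≤# {n = zero} b? p? excl f = z≤n
sum≤# {n = suc n} b? p? excl f with b? zero
... | no _ = sum≤# (b? ∘ suc) p? (λ s≢t → excl (s≢t ∘ Fin.suc-injective)) f
-- After one witness, exclusion makes every later one absurd, so the tail is compared with the
-- indicator of the empty type.
... | yes b = ℕ.≤-trans
  (s≤s (sum≤# (b? ∘ suc) (no (λ (x : ⊥) → x)) (λ s≢t → excl (s≢t ∘ Fin.suc-injective)) (excl (λ ()) b)))
  (#-mono (λ _ → f b) (yes b) p?)

sum-∈ : ∀ {n} (S : Subset n) → sum (λ i → # (i ∈? S)) ≡ ∣ S ∣
sum-∈ []          = refl
sum-∈ (true ∷ S)  = cong suc (sum-∈ S)
sum-∈ (false ∷ S) = sum-∈ S

-- Sums run over ordered pairs, so an undirected edge counts twice; hence the factors 2 in the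
-- bounds.
sum₂ : ∀ {n} → (Fin n → Fin n → ℕ) → ℕ
sum₂ f = sum λ i → sum (f i)

sum₂-mono : ∀ {n} {f g : Fin n → Fin n → ℕ} → (∀ i j → f i j ≤ g i j) → sum₂ f ≤ sum₂ g
sum₂-mono f≤g = sum-mono λ i → sum-mono (f≤g i)

sum₂-+ : ∀ {n} (f g : Fin n → Fin n → ℕ) → sum₂ (λ i j → f i j + g i j) ≡ sum₂ f + sum₂ g
sum₂-+ f g = trans (sum-cong-≗ λ i → ∑-distrib-+ (f i) (g i)) (∑-distrib-+ (sum ∘ f) (sum ∘ g))

sum-sum₂ : ∀ {m n} (f : Fin m → Fin n → Fin n → ℕ) →
           sum (λ t → sum₂ (f t)) ≡ sum₂ (λ i j → sum (λ t → f t i j))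
sum-sum₂ f = trans (∑-comm (λ t i → sum (f t i))) (sum-cong-≗ λ i → ∑-comm (λ t j → f t i j))

sum₂-∈-∈ : ∀ {n} (S : Subset n) → sum₂ (λ i j → # ((i ∈? S) ×-dec (j ∈? S))) ≡ ∣ S ∣ * ∣ S ∣
sum₂-∈-∈ S = begin
  sum₂ (λ i j → # ((i ∈? S) ×-dec (j ∈? S)))
    ≡⟨ (sum-cong-≗ λ i → trans (sum-cong-≗ λ j → #-× (i ∈? S) (j ∈? S)) (sym (*-distribˡ-sum (# (i ∈? S)) (λ j → # (j ∈? S))))) ⟩
  sum (λ i → # (i ∈? S) * sum (λ j → # (j ∈? S)))
    ≡⟨ *-distribʳ-sum (sum (λ j → # (j ∈? S))) (λ i → # (i ∈? S)) ⟨
  sum (λ i → # (i ∈? S)) * sum (λ j → # (j ∈? S))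
    ≡⟨ cong₂ _*_ (sum-∈ S) (sum-∈ S) ⟩
  ∣ S ∣ * ∣ S ∣ ∎
  where open ≡-Reasoning

length≤sum₂ : ∀ {n} {B : Fin n → Fin n → Set} (b? : ∀ i j → Dec (B i j)) {L : List (Fin n × Fin n)} →
              Unique L → (∀ {i j} → (i , j) ∈ˡ L → B i j) → length L ≤ sum₂ (λ i j → # (b? i j))
length≤sum₂ {n} b? {L} u sound = ℕ.≤-trans (count u)
  (sum₂-mono λ i j → #-mono sound ((i , j) ∈ˡ? L) (b? i j))
  where
  open DecMembership (≡-dec (_≟_ {n}) (_≟_ {n})) renaming (_∈?_ to _∈ˡ?_)
  count : ∀ {L} → Unique L → length L ≤ sum₂ (λ i j → # ((i , j) ∈ˡ? L))
  count [] = z≤n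
  count {(a , b) ∷ L} (e∉ ∷ u) = begin
    1 + length L
      ≤⟨ ℕ.+-mono-≤ one (count u) ⟩
    sum₂ (λ i j → # (at? i j)) + sum₂ (λ i j → # ((i , j) ∈ˡ? L))
      ≡⟨ sum₂-+ (λ i j → # (at? i j)) (λ i j → # ((i , j) ∈ˡ? L)) ⟨
    sum₂ (λ i j → # (at? i j) + # ((i , j) ∈ˡ? L))
      ≤⟨ (sum₂-mono λ i j → #-disjoint (λ { (refl , refl) → here refl }) there
            (λ { (refl , refl) e∈ → All.lookup e∉ e∈ refl }) (at? i j) ((i , j) ∈ˡ? L) ((i , j) ∈ˡ? ((a , b) ∷ L))) ⟩
    sum₂ (λ i j → # ((i , j) ∈ˡ? ((a , b) ∷ L))) ∎
    where
    open ℕ.≤-Reasoning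
    at? : ∀ i j → Dec (i ≡ a × j ≡ b)
    at? i j = (i ≟ a) ×-dec (j ≟ b)
    one : 1 ≤ sum₂ (λ i j → # (at? i j))
    one = ℕ.≤-trans (#≤sum (at? a) (yes refl) (λ (_ : a ≡ a) → b , refl , refl))
            (term≤sum (λ i → sum (λ j → # (at? i j))) a)

-- Edges that meet `S`, and the bounds on a disjoint family.

Meets : ∀ {n} → Subset n → Fin n → Fin n → Set
Meets S i j = i ∈ S ⊎ j ∈ S

meets? : ∀ {n} (S : Subset n) i j → Dec (Meets S i j)
meets? S i j = (i ∈? S) ⊎-dec (j ∈? S)

-- Distinct vertices of S have distinct parent edges, and each edge is counted
-- in both directions.
edgesMeeting : ∀ {n} {G : Graph n} (H : Subgraph G) {S : Subset n} {r} → S ⊆ V H → Parents H r →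
               2 * ∣ S ∣ ≤ sum₂ (λ i j → # (meets? S i j ×-dec adj? (E H) i j)) + 2 * # (r ∈? S)
edgesMeeting {n} H {S} {r} S⊆V parents = begin
  2 * ∣ S ∣
    ≡⟨ cong (2 *_) (sum-∈ S) ⟨
  2 * sum (λ i → # (i ∈? S))
    ≤⟨ ℕ.*-monoʳ-≤ 2 (sum-mono λ i → #-cover (away i) (i ∈? S) (moves? i) (root? i)) ⟩
  2 * sum (λ i → # (moves? i) + # (root? i))
    ≡⟨ cong (2 *_) (∑-distrib-+ (λ i → # (moves? i)) (λ i → # (root? i))) ⟩
  2 * (sum (λ i → # (moves? i)) + sum (λ i → # (root? i)))
    ≤⟨ ℕ.*-monoʳ-≤ 2 (ℕ.+-mono-≤ (sum-mono λ i → #≤sum (up? i) (moves? i) λ (i∈ , i≢r) → parent i , i∈ , i≢r , refl)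
         (sum≤# root? (r ∈? S) (λ { i≢j (refl , _) (refl , _) → i≢j refl }) λ { (refl , r∈) → r∈ })) ⟩
  2 * (sum₂ (λ i j → # (up? i j)) + # (r ∈? S))
    ≡⟨ arith (sum₂ λ i j → # (up? i j)) (# (r ∈? S)) ⟩
  sum₂ (λ i j → # (up? i j)) + sum₂ (λ i j → # (up? i j)) + 2 * # (r ∈? S)
    ≡⟨ cong (λ x → sum₂ (λ i j → # (up? i j)) + x + 2 * # (r ∈? S)) (∑-comm λ i j → # (up? i j)) ⟩
  sum₂ (λ i j → # (up? i j)) + sum₂ (λ i j → # (up? j i)) + 2 * # (r ∈? S)
    ≡⟨ cong (_+ 2 * # (r ∈? S)) (sum₂-+ (λ i j → # (up? i j)) (λ i j → # (up? j i))) ⟨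
  sum₂ (λ i j → # (up? i j) + # (up? j i)) + 2 * # (r ∈? S)
    ≤⟨ ℕ.+-monoˡ-≤ (2 * # (r ∈? S)) (sum₂-mono λ i j →
         #-disjoint forward backward (λ u u′ → ℕ.<-asym (up-depth u) (up-depth u′))
           (up? i j) (up? j i) (meets? S i j ×-dec adj? (E H) i j)) ⟩
  sum₂ (λ i j → # (meets? S i j ×-dec adj? (E H) i j)) + 2 * # (r ∈? S) ∎
  where
  open ℕ.≤-Reasoning
  open Parents parents
  Moves : Fin n → Set
  Moves i = i ∈ S × i ≢ r
  moves? : ∀ i → Dec (Moves i)
  moves? i = (i ∈? S) ×-dec ¬? (i ≟ r)
  root? : ∀ i → Dec (i ≡ r × r ∈ S)
  root? i = (i ≟ r) ×-dec (r ∈? S)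
  Up : Fin n → Fin n → Set
  Up i j = i ∈ S × i ≢ r × j ≡ parent i
  up? : ∀ i j → Dec (Up i j)
  up? i j = (i ∈? S) ×-dec ¬? (i ≟ r) ×-dec (j ≟ parent i)
  away : ∀ i → i ∈ S → Moves i ⊎ (i ≡ r × r ∈ S)
  away i i∈ with i ≟ r
  ... | yes refl = inj₂ (refl , i∈)
  ... | no i≢r = inj₁ (i∈ , i≢r)
  up-depth : ∀ {i j} → Up i j → depth j < depth i
  up-depth (i∈ , i≢r , refl) = parent-depth (S⊆V i∈) i≢r
  forward : ∀ {i j} → Up i j → Meets S i j × Adj (E H) i j
  forward (i∈ , i≢r , refl) = inj₁ i∈ , parent-adj (S⊆V i∈) i≢r
  backward : ∀ {i j} → Up j i → Meets S i j × Adj (E H) i j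
  backward (j∈ , j≢r , refl) = inj₂ j∈ , Adj-sym (E H) (parent-adj (S⊆V j∈) j≢r)
  arith : ∀ u r → 2 * (u + r) ≡ u + u + 2 * r
  arith = solve-∀

module Packing {n m} {G : Graph n} {S : Subset n} (S-nonempty : Nonempty S) (family : DisjointTrees G S m) where

  private
    k : ℕ
    k = ∣ S ∣

    H : Fin m → Subgraph G
    H t = tree (proj₁ family t)

    disjoint : ∀ {s t} → s ≢ t → InternallyDisjoint (proj₁ family s) (proj₁ family t)
    disjoint s≢t = proj₂ family _ _ s≢t

    S⊆V : ∀ t → S ⊆ V (H t)
    S⊆V t = TreeConnecting.S⊆V (proj₁ family t)

    Exterior : Fin m → Set
    Exterior t = ∃ λ v → v ∈ V (H t) × v ∉ S

    exterior? : ∀ t → Dec (Exterior t)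
    exterior? t = Fin.any? λ v → (v ∈? V (H t)) ×-dec ¬? (v ∈? S)

    interior? : ∀ t → Dec (¬ Exterior t)
    interior? t = ¬? (exterior? t)

    interior⊆S : ∀ {t} → ¬ Exterior t → V (H t) ⊆ S
    interior⊆S int v∈ = decidable-stable (_ ∈? S) λ v∉ → int (_ , v∈ , v∉)

    meeting? : ∀ t i j → Dec (Meets S i j × Adj (E (H t)) i j)
    meeting? t i j = meets? S i j ×-dec adj? (E (H t)) i j

    -- With a root outside `S` all `k` vertices of `S` have parent edges. A tree without vertices
    -- outside `S` has its root in `S` and falls short by one edge, that is, by two ordered pairs.
    perTree : ∀ t → 2 * k ≤ sum₂ (λ i j → # (meeting? t i j)) + 2 * # (interior? t)
    perTree t with root
      where
      root : ∃[ r ] r ∈ V (H t) × (r ∈ S → ¬ Exterior t)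
      root with exterior? t
      ... | yes (v , v∈ , v∉) = v , v∈ , λ v∈S → contradiction v∈S v∉
      ... | no int = let s , s∈ = S-nonempty in s , S⊆V t s∈ , λ _ → int
    ... | r , r∈ , r-int = ℕ.≤-trans
      (edgesMeeting (H t) (S⊆V t) (parents (H t) r∈ (IsTree.connected (TreeConnecting.isTree (proj₁ family t)))))
      (ℕ.+-monoʳ-≤ (sum₂ (λ i j → # (meeting? t i j))) (ℕ.*-monoʳ-≤ 2 (#-mono r-int (r ∈? S) (interior? t))))

    Inside : Fin n → Fin n → Set
    Inside i j = i ∈ S × j ∈ S

    inside? : ∀ i j → Dec (Inside i j)
    inside? i j = (i ∈? S) ×-dec (j ∈? S)

    interiorEdge? : ∀ t i j → Dec (¬ Exterior t × Inside i j × Adj (E (H t)) i j)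
    interiorEdge? t i j = interior? t ×-dec inside? i j ×-dec adj? (E (H t)) i j

    -- All edges of an interior tree lie inside `S`. The indicator as a factor makes the inequality
    -- true for every tree, ready for summation.
    perInteriorTree : ∀ t → # (interior? t) * (2 * k) ≤
                            sum₂ (λ i j → # (interiorEdge? t i j)) + # (interior? t) * 2
    perInteriorTree t = restrict (interior? t) (perTree t)
      where
      ends : ¬ Exterior t → ∀ {i j} → Adj (E (H t)) i j → Inside i j
      ends int e = let i∈ , j∈ = Subgraph.ends∈ (H t) e in interior⊆S int i∈ , interior⊆S int j∈
      restrict : (int? : Dec (¬ Exterior t)) →
                 2 * k ≤ sum₂ (λ i j → # (meeting? t i j)) + 2 * # int? →
                 # int? * (2 * k) ≤
                 sum₂ (λ i j → # (int? ×-dec inside? i j ×-dec adj? (E (H t)) i j)) + # int? * 2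
      restrict (no _)        _  = z≤n
      restrict int?@(yes int) le = ℕ.≤-trans (ℕ.≤-reflexive (ℕ.+-identityʳ (2 * k))) (ℕ.≤-trans le
        (ℕ.+-monoˡ-≤ 2 (sum₂-mono λ i j → #-mono (λ (_ , e) → int , ends int e , e) (meeting? t i j)
          (int? ×-dec inside? i j ×-dec adj? (E (H t)) i j))))

    diagonal? : ∀ i j → Dec (i ∈ S × j ≡ i)
    diagonal? i j = (i ∈? S) ×-dec (j ≟ i)

    k≤diagonal : k ≤ sum₂ (λ i j → # (diagonal? i j))
    k≤diagonal = ℕ.≤-trans (ℕ.≤-reflexive (sym (sum-∈ S)))
      (sum-mono λ i → #≤sum (diagonal? i) (i ∈? S) λ i∈ → i , i∈ , refl)

  interiorCount : ℕ
  interiorCount = sum λ t → # (interior? t)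

  private
    properPair? : ∀ i j → Dec (Inside i j × j ≢ i)
    properPair? i j = inside? i j ×-dec ¬? (j ≟ i)

    properPairs : ℕ
    properPairs = sum₂ λ i j → # (properPair? i j)

    properPairs+k : properPairs + k ≤ k * k
    properPairs+k = begin
      properPairs + k
        ≤⟨ ℕ.+-monoʳ-≤ properPairs k≤diagonal ⟩
      properPairs + sum₂ (λ i j → # (diagonal? i j))
        ≡⟨ sum₂-+ (λ i j → # (properPair? i j)) (λ i j → # (diagonal? i j)) ⟨
      sum₂ (λ i j → # (properPair? i j) + # (diagonal? i j))
        ≤⟨ (sum₂-mono λ i j → #-disjoint proj₁ (λ { (i∈ , refl) → i∈ , i∈ }) (λ (_ , j≢i) (_ , j≡i) → j≢i j≡i)
              (properPair? i j) (diagonal? i j) (inside? i j)) ⟩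
      sum₂ (λ i j → # (inside? i j))
        ≡⟨ sum₂-∈-∈ S ⟩
      k * k ∎
      where open ℕ.≤-Reasoning

  -- Interior trees have k - 1 edges each and share the k(k - 1)/2 pairs inside `S`; the inequality
  -- is doubled and written without subtraction.
  interiorBound : interiorCount * (2 * k) + k ≤ k * k + interiorCount * 2
  interiorBound = begin
    interiorCount * (2 * k) + k
      ≡⟨ cong (_+ k) (*-distribʳ-sum (2 * k) (λ t → # (interior? t))) ⟩
    sum (λ t → # (interior? t) * (2 * k)) + k
      ≤⟨ ℕ.+-monoˡ-≤ k (sum-mono perInteriorTree) ⟩
    sum (λ t → sum₂ (λ i j → # (interiorEdge? t i j)) + # (interior? t) * 2) + k
      ≡⟨ cong (_+ k) (∑-distrib-+ (λ t → sum₂ (λ i j → # (interiorEdge? t i j))) (λ t → # (interior? t) * 2)) ⟩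
    sum (λ t → sum₂ (λ i j → # (interiorEdge? t i j))) + sum (λ t → # (interior? t) * 2) + k
      ≡⟨ cong₂ (λ x y → x + y + k) (sum-sum₂ (λ t i j → # (interiorEdge? t i j)))
           (sym (*-distribʳ-sum 2 (λ t → # (interior? t)))) ⟩
    sum₂ (λ i j → sum (λ t → # (interiorEdge? t i j))) + interiorCount * 2 + k
      ≤⟨ ℕ.+-monoˡ-≤ k (ℕ.+-monoˡ-≤ (interiorCount * 2) (sum₂-mono λ i j →
           sum≤# (λ t → interiorEdge? t i j) (properPair? i j)
             (λ s≢t (_ , _ , e) (_ , _ , e′) → proj₁ (disjoint s≢t) i j e e′)
             (λ {t} (_ , ends , e) → ends , λ { refl → Adj-irrefl (E (H t)) e }))) ⟩
    properPairs + interiorCount * 2 + k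
      ≡⟨ arith properPairs (interiorCount * 2) k ⟩
    properPairs + k + interiorCount * 2
      ≤⟨ ℕ.+-monoˡ-≤ (interiorCount * 2) properPairs+k ⟩
    k * k + interiorCount * 2 ∎
    where
    open ℕ.≤-Reasoning
    arith : ∀ a b c → a + b + c ≡ a + c + b
    arith = solve-∀

  -- Each exterior tree has a vertex among the n - k outside `S`, and no two share one.
  countBound : m + k ≤ n + interiorCount
  countBound = begin
    m + k
      ≡⟨ cong₂ _+_ total (sym (sum-∈ S)) ⟩
    sum (λ t → # (exterior? t)) + interiorCount + sum (λ v → # (v ∈? S))
      ≤⟨ ℕ.+-monoˡ-≤ _ (ℕ.+-monoˡ-≤ interiorCount exteriors) ⟩
    sum (λ v → # (outside? v)) + interiorCount + sum (λ v → # (v ∈? S))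
      ≡⟨ arith (sum (λ v → # (outside? v))) interiorCount (sum (λ v → # (v ∈? S))) ⟩
    sum (λ v → # (v ∈? S)) + sum (λ v → # (outside? v)) + interiorCount
      ≡⟨ cong (_+ interiorCount) (trans (sym (∑-distrib-+ (λ v → # (v ∈? S)) (λ v → # (outside? v))))
           (trans (sum-cong-≗ (λ v → #-¬ (v ∈? S))) (trans (sum-const n 1) (ℕ.*-identityʳ n)))) ⟩
    n + interiorCount ∎
    where
    open ℕ.≤-Reasoning
    outside? : ∀ v → Dec (v ∉ S)
    outside? v = ¬? (v ∈? S)
    extra? : ∀ t v → Dec (v ∈ V (H t) × v ∉ S)
    extra? t v = (v ∈? V (H t)) ×-dec outside? v
    total : m ≡ sum (λ t → # (exterior? t)) + interiorCount
    total = sym (trans (sym (∑-distrib-+ (λ t → # (exterior? t)) (λ t → # (interior? t))))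
      (trans (sum-cong-≗ (λ t → #-¬ (exterior? t))) (trans (sum-const m 1) (ℕ.*-identityʳ m))))
    exteriors : sum (λ t → # (exterior? t)) ≤ sum (λ v → # (outside? v))
    exteriors = begin
      sum (λ t → # (exterior? t))
        ≤⟨ (sum-mono λ t → #≤sum (extra? t) (exterior? t) λ ext → ext) ⟩
      sum (λ t → sum (λ v → # (extra? t v)))
        ≡⟨ ∑-comm (λ t v → # (extra? t v)) ⟩
      sum (λ v → sum (λ t → # (extra? t v)))
        ≤⟨ (sum-mono λ v → sum≤# (λ t → extra? t v) (outside? v)
             (λ s≢t (v∈s , v∉) (v∈t , _) → v∉ (subst (v ∈_) (proj₂ (disjoint s≢t)) (x∈p∩q⁺ (v∈s , v∈t)))) proj₂) ⟩
      sum (λ v → # (outside? v)) ∎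
    arith : ∀ a b c → a + b + c ≡ c + a + b
    arith = solve-∀

  private
    Missing : Fin n → Fin n → Set
    Missing i j = i ≢ j × ¬ Adj G i j

    missing? : ∀ i j → Dec (Missing i j)
    missing? i j = ¬? (i ≟ j) ×-dec ¬? (adj? G i j)

    missingMeeting? : ∀ i j → Dec (Meets S i j × Missing i j)
    missingMeeting? i j = meets? S i j ×-dec missing? i j

    present? : ∀ i j → Dec (Meets S i j × Adj G i j)
    present? i j = meets? S i j ×-dec adj? G i j

    missings presents : ℕ
    missings = sum₂ λ i j → # (missingMeeting? i j)
    presents = sum₂ λ i j → # (present? i j)

    trees≤presents : m * (2 * k) ≤ presents + 2 * interiorCount
    trees≤presents = begin
      m * (2 * k)
        ≡⟨ sum-const m (2 * k) ⟨
      sum {m} (λ _ → 2 * k)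
        ≤⟨ sum-mono perTree ⟩
      sum (λ t → sum₂ (λ i j → # (meeting? t i j)) + 2 * # (interior? t))
        ≡⟨ ∑-distrib-+ (λ t → sum₂ (λ i j → # (meeting? t i j))) (λ t → 2 * # (interior? t)) ⟩
      sum (λ t → sum₂ (λ i j → # (meeting? t i j))) + sum (λ t → 2 * # (interior? t))
        ≡⟨ cong₂ _+_ (sum-sum₂ (λ t i j → # (meeting? t i j))) (sym (*-distribˡ-sum 2 (λ t → # (interior? t)))) ⟩
      sum₂ (λ i j → sum (λ t → # (meeting? t i j))) + 2 * interiorCount
        ≤⟨ ℕ.+-monoˡ-≤ (2 * interiorCount) (sum₂-mono λ i j → sum≤# (λ t → meeting? t i j) (present? i j)
             (λ s≢t (_ , e) (_ , e′) → proj₁ (disjoint s≢t) i j e e′)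
             (λ {t} (meets , e) → meets , Subgraph.E⊆G (H t) e)) ⟩
      presents + 2 * interiorCount ∎
      where open ℕ.≤-Reasoning

    -- By inclusion-exclusion 2nk - k² ordered pairs meet `S`, and k of them are diagonal; the
    -- others are present or missing.
    pairs : presents + missings + k + k * k ≤ n * k + n * k
    pairs = begin
      presents + missings + k + k * k
        ≤⟨ ℕ.+-mono-≤ (ℕ.+-monoʳ-≤ (presents + missings) k≤diagonal) (ℕ.≤-reflexive (sym (sum₂-∈-∈ S))) ⟩
      presents + missings + sum₂ (λ i j → # (diagonal? i j)) + sum₂ (λ i j → # (inside? i j))
        ≡⟨ cong (λ x → x + sum₂ (λ i j → # (diagonal? i j)) + sum₂ (λ i j → # (inside? i j)))
             (sum₂-+ (λ i j → # (present? i j)) (λ i j → # (missingMeeting? i j))) ⟨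
      sum₂ (λ i j → # (present? i j) + # (missingMeeting? i j)) + sum₂ (λ i j → # (diagonal? i j)) + sum₂ (λ i j → # (inside? i j))
        ≡⟨ cong (_+ sum₂ (λ i j → # (inside? i j)))
             (sum₂-+ (λ i j → # (present? i j) + # (missingMeeting? i j)) (λ i j → # (diagonal? i j))) ⟨
      sum₂ (λ i j → # (present? i j) + # (missingMeeting? i j) + # (diagonal? i j)) + sum₂ (λ i j → # (inside? i j))
        ≡⟨ sum₂-+ (λ i j → # (present? i j) + # (missingMeeting? i j) + # (diagonal? i j)) (λ i j → # (inside? i j)) ⟨
      sum₂ (λ i j → # (present? i j) + # (missingMeeting? i j) + # (diagonal? i j) + # (inside? i j))
        ≤⟨ sum₂-mono pointwise ⟩
      sum₂ (λ i j → # (i ∈? S) + # (j ∈? S))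
        ≡⟨ sum₂-+ (λ i j → # (i ∈? S)) (λ i j → # (j ∈? S)) ⟩
      sum₂ (λ i j → # (i ∈? S)) + sum₂ {n} (λ i j → # (j ∈? S))
        ≡⟨ cong (_+ sum₂ {n} (λ i j → # (j ∈? S))) (∑-comm (λ i (j : Fin n) → # (i ∈? S))) ⟩
      sum₂ {n} (λ i j → # (j ∈? S)) + sum₂ {n} (λ i j → # (j ∈? S))
        ≡⟨ cong₂ _+_ rows rows ⟩
      n * k + n * k ∎
      where
      open ℕ.≤-Reasoning
      rows : sum₂ {n} (λ i j → # (j ∈? S)) ≡ n * k
      rows = trans (sum-const n _) (cong (n *_) (sum-∈ S))
      pair? : ∀ i j → Dec (Meets S i j × i ≢ j)
      pair? i j = meets? S i j ×-dec ¬? (i ≟ j)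
      inclusion-exclusion : ∀ i j → # (meets? S i j) + # (inside? i j) ≤ # (i ∈? S) + # (j ∈? S)
      inclusion-exclusion i j with i ∈? S | j ∈? S
      ... | yes _ | yes _ = ℕ.≤-refl
      ... | yes _ | no _  = ℕ.≤-refl
      ... | no _  | yes _ = ℕ.≤-refl
      ... | no _  | no _  = ℕ.≤-refl
      pointwise : ∀ i j → # (present? i j) + # (missingMeeting? i j) + # (diagonal? i j) + # (inside? i j) ≤
                          # (i ∈? S) + # (j ∈? S)
      pointwise i j = ℕ.≤-trans (ℕ.+-monoˡ-≤ (# (inside? i j)) (begin
        # (present? i j) + # (missingMeeting? i j) + # (diagonal? i j)
          ≤⟨ ℕ.+-monoˡ-≤ (# (diagonal? i j)) (#-disjoint
               (λ (meets , e) → meets , λ { refl → Adj-irrefl G e }) (λ (meets , i≢j , _) → meets , i≢j)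
               (λ (_ , e) (_ , _ , ¬e) → ¬e e) (present? i j) (missingMeeting? i j) (pair? i j)) ⟩
        # (pair? i j) + # (diagonal? i j)
          ≤⟨ #-disjoint proj₁ (λ (i∈ , _) → inj₁ i∈) (λ (_ , i≢j) (_ , j≡i) → i≢j (sym j≡i))
               (pair? i j) (diagonal? i j) (meets? S i j) ⟩
        # (meets? S i j) ∎)) (inclusion-exclusion i j)

  -- The trees use up present pairs, and each listed non-edge fills two of the missing ones; the
  -- condition `i <ᶠ j` prevents listing it in both directions.
  edgeBound : ∀ {L : List (Fin n × Fin n)} → Unique L →
              (∀ {i j} → (i , j) ∈ˡ L → i ∈ S × i <ᶠ j × ¬ Adj G i j) →
              m * (2 * k) + 2 * length L + k + k * k ≤ n * k + n * k + 2 * interiorCount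
  edgeBound {L} u sound = begin
    m * (2 * k) + 2 * length L + k + k * k
      ≤⟨ ℕ.+-monoˡ-≤ (k * k) (ℕ.+-monoˡ-≤ k (ℕ.+-mono-≤ trees≤presents listed)) ⟩
    presents + 2 * interiorCount + missings + k + k * k
      ≡⟨ arith presents (2 * interiorCount) missings k (k * k) ⟩
    presents + missings + k + k * k + 2 * interiorCount
      ≤⟨ ℕ.+-monoˡ-≤ (2 * interiorCount) pairs ⟩
    n * k + n * k + 2 * interiorCount ∎
    where
    open ℕ.≤-Reasoning
    arith : ∀ a b c d e → a + b + c + d + e ≡ a + c + d + e + b
    arith = solve-∀
    Listed : Fin n → Fin n → Set
    Listed i j = i ∈ S × i <ᶠ j × ¬ Adj G i j
    listed? : ∀ i j → Dec (Listed i j)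
    listed? i j = (i ∈? S) ×-dec (i <ᶠ? j) ×-dec ¬? (adj? G i j)
    listed : 2 * length L ≤ missings
    listed = begin
      2 * length L
        ≤⟨ ℕ.*-monoʳ-≤ 2 (length≤sum₂ listed? u sound) ⟩
      2 * sum₂ (λ i j → # (listed? i j))
        ≡⟨ cong (sum₂ (λ i j → # (listed? i j)) +_)
             (trans (ℕ.+-identityʳ _) (∑-comm (λ i j → # (listed? i j)))) ⟩
      sum₂ (λ i j → # (listed? i j)) + sum₂ (λ i j → # (listed? j i))
        ≡⟨ sum₂-+ (λ i j → # (listed? i j)) (λ i j → # (listed? j i)) ⟨
      sum₂ (λ i j → # (listed? i j) + # (listed? j i))
        ≤⟨ (sum₂-mono λ i j → #-disjoint
             (λ (i∈ , i<j , ¬e) → inj₁ i∈ , Fin.<⇒≢ i<j , ¬e)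
             (λ (j∈ , j<i , ¬e) → inj₂ j∈ , Fin.<⇒≢ j<i ∘ sym , ¬e ∘ Adj-sym G)
             (λ (_ , i<j , _) (_ , j<i , _) → Fin.<-asym i<j j<i)
             (listed? i j) (listed? j i) (missingMeeting? i j)) ⟩
      missings ∎

-- Arithmetic of the bounds, by the parity of `k`.

-- Parity k c d: c = ⌈ k /2⌉, and d is the number of edges that may be missing.
data Parity : ℕ → ℕ → ℕ → Set where
  even : ∀ h → Parity (h + h) h 0
  odd  : ∀ h → Parity (suc (h + h)) (suc h) h

parity : ∀ k → ∃[ c ] ∃[ d ] Parity k c d
parity zero = 0 , 0 , even 0
parity (suc k) with parity k
... | _ , _ , even h = suc h , h , odd h
... | _ , _ , odd h = suc h , 0 , subst (λ k → Parity (suc k) (suc h) 0) (ℕ.+-suc h h) (even (suc h))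

parity-⌈/2⌉ : ∀ {k c d} → Parity k c d → c ≡ ⌈ k /2⌉
parity-⌈/2⌉ (even h) = ℕ.n≡⌈n+n/2⌉ h
parity-⌈/2⌉ (odd h)  = cong suc (ℕ.n≡⌊n+n/2⌋ h)

2∣h+h : ∀ h → 2 ∣ h + h
2∣h+h h = divides h (trans (cong (h +_) (sym (ℕ.+-identityʳ h))) (ℕ.*-comm 2 h))

2∤1+h+h : ∀ h → ¬ 2 ∣ suc (h + h)
2∤1+h+h h 2∣ with ∣⇒≤ (∣m+n∣m⇒∣n (subst (2 ∣_) (ℕ.+-comm 1 (h + h)) 2∣) (2∣h+h h))
... | s≤s ()

-- The extra unit on the right is lost to parity.
double-cancel-≤ : ∀ {a b} → a + a ≤ suc (b + b) → a ≤ b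
double-cancel-≤ {a} {b} le with a ≤? b
... | yes a≤b = a≤b
... | no a≰b = contradiction (begin
  suc (suc (b + b))   ≡⟨ cong suc (ℕ.+-suc b b) ⟨
  suc b + suc b       ≤⟨ ℕ.+-mono-≤ (ℕ.≰⇒> a≰b) (ℕ.≰⇒> a≰b) ⟩
  a + a               ≤⟨ le ⟩
  suc (b + b)         ∎) ℕ.1+n≰n
  where open ℕ.≤-Reasoning

module _ {k c d T : ℕ} (2≤k : 2 ≤ k) (parity : Parity k c d) (interior : T * (2 * k) + k ≤ k * k + T * 2) where

  private
    -- This is 2T(k - 1) ≤ k(k - 1) divided by k - 1, which is positive.
    T+T≤k : T + T ≤ k
    T+T≤k = lemma 2≤k interior
      where
      lemma : ∀ {k} → 2 ≤ k → T * (2 * k) + k ≤ k * k + T * 2 → T + T ≤ k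
      lemma {suc zero} (s≤s ()) _
      lemma {suc (suc k)} _ le = ℕ.*-cancelʳ-≤ _ _ (suc k)
        (ℕ.+-cancelʳ-≤ (suc (suc k) + T * 2) _ _ (subst₂ _≤_ (left T k) (right T k) le))
        where
        left : ∀ T k → T * (2 * suc (suc k)) + suc (suc k) ≡ (T + T) * suc k + (suc (suc k) + T * 2)
        left = solve-∀
        right : ∀ T k → suc (suc k) * suc (suc k) + T * 2 ≡ suc (suc k) * suc k + (suc (suc k) + T * 2)
        right = solve-∀

    T+c≤k : T + c ≤ k
    T+c≤k = lemma parity T+T≤k
      where
      lemma : ∀ {k c d} → Parity k c d → T + T ≤ k → T + c ≤ k
      lemma (even h) le = ℕ.+-monoˡ-≤ h (double-cancel-≤ (ℕ.m≤n⇒m≤1+n le))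
      lemma (odd h)  le = ℕ.≤-trans (ℕ.≤-reflexive (ℕ.+-suc T h)) (s≤s (ℕ.+-monoˡ-≤ h (double-cancel-≤ le)))

  -- At most n - k + T trees exist, and T ≤ k - c.
  treeBound : ∀ {m n} → m + k ≤ n + T → m + c ≤ n
  treeBound {m} {n} le = ℕ.+-cancelʳ-≤ T _ _ (begin
    m + c + T    ≡⟨ ℕ.+-assoc m c T ⟩
    m + (c + T)  ≡⟨ cong (m +_) (ℕ.+-comm c T) ⟩
    m + (T + c)  ≤⟨ ℕ.+-monoʳ-≤ m T+c≤k ⟩
    m + k        ≤⟨ le ⟩
    n + T        ∎)
    where open ℕ.≤-Reasoning

  -- Here m + c stands for n. With `T` replaced by its bound ⌊k/2⌋, everything cancels except 2ℓ ≤
  -- 2d.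
  missingBound : ∀ {m ℓ} → m * (2 * k) + 2 * ℓ + k + k * k ≤ (m + c) * k + (m + c) * k + 2 * T → ℓ ≤ d
  missingBound {m} {ℓ} = lemma parity T+c≤k
    where
    cancel : ∀ {lhs} x {t y d} → T ≤ t → lhs ≡ 2 * ℓ + y → x + 2 * t ≡ 2 * d + y → lhs ≤ x + 2 * T → ℓ ≤ d
    cancel {lhs} x {t} {y} {d} T≤t left right le = ℕ.*-cancelˡ-≤ 2 (ℕ.+-cancelʳ-≤ y _ _ (begin
      2 * ℓ + y  ≡⟨ left ⟨
      lhs        ≤⟨ le ⟩
      x + 2 * T  ≤⟨ ℕ.+-monoʳ-≤ x (ℕ.*-monoʳ-≤ 2 T≤t) ⟩
      x + 2 * t  ≡⟨ right ⟩
      2 * d + y  ∎))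
      where open ℕ.≤-Reasoning
    lemma : ∀ {k c d} → Parity k c d → T + c ≤ k →
            m * (2 * k) + 2 * ℓ + k + k * k ≤ (m + c) * k + (m + c) * k + 2 * T → ℓ ≤ d
    lemma (even h) T+c≤k = cancel ((m + h) * (h + h) + (m + h) * (h + h)) (ℕ.+-cancelʳ-≤ h T h T+c≤k) (left m ℓ h) (right m h)
      where
      left : ∀ m ℓ h → m * (2 * (h + h)) + 2 * ℓ + (h + h) + (h + h) * (h + h)
                       ≡ 2 * ℓ + (m * (2 * (h + h)) + (h + h) + (h + h) * (h + h))
      left = solve-∀
      right : ∀ m h → (m + h) * (h + h) + (m + h) * (h + h) + 2 * h
                      ≡ 2 * 0 + (m * (2 * (h + h)) + (h + h) + (h + h) * (h + h))
      right = solve-∀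
    lemma (odd h) T+c≤k = cancel ((m + suc h) * suc (h + h) + (m + suc h) * suc (h + h))
      (ℕ.+-cancelʳ-≤ (suc h) T h (ℕ.≤-trans T+c≤k (ℕ.≤-reflexive (sym (ℕ.+-suc h h))))) (left m ℓ h) (right m h)
      where
      left : ∀ m ℓ h → m * (2 * suc (h + h)) + 2 * ℓ + suc (h + h) + suc (h + h) * suc (h + h)
                       ≡ 2 * ℓ + (m * (2 * suc (h + h)) + suc (h + h) + suc (h + h) * suc (h + h))
      left = solve-∀
      right : ∀ m h → (m + suc h) * suc (h + h) + (m + suc h) * suc (h + h) + 2 * h
                      ≡ 2 * h + (m * (2 * suc (h + h)) + suc (h + h) + suc (h + h) * suc (h + h))
      right = solve-∀

-- Families for a fixed set `S`: upper and lower bound.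

nonempty : ∀ {n} {S : Subset n} → 2 ≤ ∣ S ∣ → Nonempty S
nonempty {n} {S} 2≤ with nonempty? S
... | yes ne = ne
... | no empty with () ← subst (2 ≤_) (trans (cong ∣_∣ (Empty-unique empty)) (∣⊥∣≡0 n)) 2≤

module _ {n m k c d} {G : Graph n} {S : Subset n} (2≤k : 2 ≤ k) (par : Parity k c d) (S-size : ∣ S ∣ ≡ k)
         (family : DisjointTrees G S m) where

  private
    module P = Packing (nonempty (subst (2 ≤_) (sym S-size) 2≤k)) family

    interior : P.interiorCount * (2 * k) + k ≤ k * k + P.interiorCount * 2
    interior = subst (λ k → P.interiorCount * (2 * k) + k ≤ k * k + P.interiorCount * 2) S-size P.interiorBound

  familySize≤ : m + c ≤ n
  familySize≤ = treeBound {T = P.interiorCount} 2≤k par interior (subst (λ k → m + k ≤ n + P.interiorCount) S-size P.countBound)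

  missing≤ : m + c ≡ n → ∀ {L : List (Fin n × Fin n)} → Unique L →
             (∀ {i j} → (i , j) ∈ˡ L → i ∈ S × i <ᶠ j × ¬ Adj G i j) → length L ≤ d
  missing≤ m+c≡n {L} u sound = missingBound {T = P.interiorCount} 2≤k par interior {m}
    (subst₂ (λ k n → m * (2 * k) + 2 * length L + k + k * k ≤ n * k + n * k + 2 * P.interiorCount)
      S-size (sym m+c≡n) (P.edgeBound u sound))

-- The ⌊k/2⌋ classes and n - k stars add up to n - ⌈k/2⌉. In both parities 2d < k, which is the room
-- that the detours take.
familyExists : ∀ {n k c d} {G : Graph n} {S : Subset n} → 2 ≤ k → k ≤ n → Parity k c d → ∣ S ∣ ≡ k →
  (Ms : List (Fin n × Fin n)) → (∀ {i j} → i ≢ j → ¬ Adj G i j → Joined Ms i j) → length Ms ≤ d →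
  DisjointTrees G S (n ∸ c)
familyExists {n} {G = G} {S} 2≤k k≤n (even h) S-size Ms missing Ms≤ = subst (DisjointTrees G S) total
  (disjointTrees-missing G S Ms missing (subst (length Ms + length Ms <_) (sym S-size) (ℕ.≤-<-trans (ℕ.+-mono-≤ Ms≤ Ms≤) (ℕ.<-trans (s≤s z≤n) 2≤k)))
    (nonempty (subst (2 ≤_) (sym S-size) 2≤k)) decompose)
  where
  decompose : ∀ {F} → length F ≤ length Ms → Decompose.Decomposition _≟_ (elements S) (Joined F) h
  decompose {[]} _ = Decompose.evenDecomposition _≟_ h (elements-unique S) (trans (elements-length S) S-size)
  decompose {_ ∷ _} F≤ with () ← ℕ.≤-trans F≤ Ms≤
  total : h + (n ∸ ∣ S ∣) ≡ n ∸ h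
  total rewrite S-size = trans (sym (ℕ.+-∸-assoc h k≤n)) (ℕ.[m+n]∸[m+o]≡n∸o h n h)
familyExists {n} {G = G} {S} 2≤k k≤n (odd h) S-size Ms missing Ms≤ = subst (DisjointTrees G S) total
  (disjointTrees-missing G S Ms missing (subst (length Ms + length Ms <_) (sym S-size) (s≤s (ℕ.+-mono-≤ Ms≤ Ms≤)))
    (nonempty (subst (2 ≤_) (sym S-size) 2≤k))
    λ {F} F≤ → Decompose.oddDecomposition _≟_ h F (elements-unique S) (trans (elements-length S) S-size) (ℕ.≤-trans F≤ Ms≤))
  where
  total : h + (n ∸ ∣ S ∣) ≡ n ∸ suc h
  total rewrite S-size = trans (sym (ℕ.+-∸-assoc h k≤n))
    (trans (cong (h + n ∸_) (sym (ℕ.+-suc h h))) (ℕ.[m+n]∸[m+o]≡n∸o h n (suc h)))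

-- Sets of prescribed size.

superset : ∀ {n} (P : Subset n) k → ∣ P ∣ ≤ k → k ≤ n → ∃[ S ] P ⊆ S × ∣ S ∣ ≡ k
superset []          zero    _         _         = [] , (λ i∈ → i∈) , refl
superset (true ∷ P)  (suc k) (s≤s P≤k) (s≤s k≤n) with S , P⊆S , size ← superset P k P≤k k≤n
  = true ∷ S , s⊆s P⊆S , cong suc size
superset {suc n} (false ∷ P) k P≤k k≤1+n with k ≤? n
... | yes k≤n with S , P⊆S , size ← superset P k P≤k k≤n = false ∷ S , s⊆s P⊆S , size
... | no k≰n = full , ⊆⊤ , trans (∣⊤∣≡n (suc n)) (ℕ.≤-antisym (ℕ.≰⇒> k≰n) k≤1+n)

-- `xs` may repeat vertices, so its set of members has at most `length xs` elements; it is then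
-- enlarged.
containing : ∀ {n} (xs : List (Fin n)) k → length xs ≤ k → k ≤ n →
             ∃[ S ] (∀ {i} → i ∈ˡ xs → i ∈ S) × ∣ S ∣ ≡ k
containing {n} xs k xs≤k k≤n =
  let S , P⊆S , size = superset P k (ℕ.≤-trans P≤xs xs≤k) k≤n in
  S , (λ {i} i∈ → P⊆S (lookup⇒[]= i P (trans (lookup∘tabulate listed i) (dec-true (i ∈ˡ? xs) i∈)))) , size
  where
  open DecMembership (_≟_ {n}) using () renaming (_∈?_ to _∈ˡ?_)
  listed : Fin n → Bool
  listed i = does (i ∈ˡ? xs)
  P : Subset n
  P = tabulate listed
  P⊆xs : ∀ {i} → i ∈ P → i ∈ˡ xs
  P⊆xs {i} i∈ = true⇒ (i ∈ˡ? xs) (trans (sym (lookup∘tabulate listed i)) ([]=⇒lookup i∈))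
    where
    true⇒ : ∀ {A : Set} (a? : Dec A) → does a? ≡ true → A
    true⇒ (yes a) _ = a
  P≤xs : ∣ P ∣ ≤ length xs
  P≤xs = subst (_≤ length xs) (elements-length P)
    (Decompose.unique⊆⇒length≤ _≟_ (elements-unique P) (P⊆xs ∘ elements⁻))

-- Complements in the complete graph.

edgeList : ∀ {n} → EdgeSet n → List (Fin n × Fin n)
edgeList {n} M = filter (λ (i , j) → (i <ᶠ? j) ×-dec T? (edge M i j)) (cartesianProduct (allFin n) (allFin n))

edgeList-unique : ∀ {n} (M : EdgeSet n) → Unique (edgeList M)
edgeList-unique {n} M = Uniqueₚ.filter⁺ _ (Uniqueₚ.cartesianProduct⁺ (Uniqueₚ.allFin⁺ n) (Uniqueₚ.allFin⁺ n))

edgeList⁻ : ∀ {n} (M : EdgeSet n) {i j} → (i , j) ∈ˡ edgeList M → i <ᶠ j × Adj M i j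
edgeList⁻ {n} M e∈ = proj₂ (∈-filter⁻ (λ (i , j) → (i <ᶠ? j) ×-dec T? (edge M i j))
  {xs = cartesianProduct (allFin n) (allFin n)} e∈)

edgeList⁺ : ∀ {n} (M : EdgeSet n) {i j} → Adj M i j → Joined (edgeList M) i j
edgeList⁺ M {i} {j} e with Fin.<-cmp i j
... | tri< i<j _ _ = inj₁ (∈-filter⁺ _ (∈-cartesianProduct⁺ (∈-allFin i) (∈-allFin j)) (i<j , e))
... | tri≈ _ refl _ = contradiction e (Adj-irrefl M)
... | tri> _ _ j<i = inj₂ (∈-filter⁺ _ (∈-cartesianProduct⁺ (∈-allFin j) (∈-allFin i)) (j<i , Adj-sym M e))

K∖⁺ : ∀ {n} (M : EdgeSet n) {i j} → i ≢ j → ¬ Adj M i j → Adj (K n ∖ M) i j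
K∖⁺ M {i} {j} i≢j ¬e with i ≟ j | edge M i j
... | yes i≡j | _     = i≢j i≡j
... | no _    | true  = ¬e _
... | no _    | false = _

K∖⁻ : ∀ {n} (M : EdgeSet n) {i j} → Adj (K n ∖ M) i j → i ≢ j × ¬ Adj M i j
K∖⁻ M {i} {j} e with i ≟ j | edge M i j
... | no i≢j | false = i≢j , λ ()

-- The complement of the complement; it lets `K n ∖ G` serve as the deleted edge set `M`.
K∖K∖ : ∀ {n} (G : Graph n) → G ≅ K n ∖ (K n ∖ G)
K∖K∖ G = Perm.id , same
  where
  same : ∀ i j → edge G i j ≡ not ⌊ i ≟ j ⌋ ∧ not (not ⌊ i ≟ j ⌋ ∧ not (edge G i j))
  same i j with i ≟ j | edge G i j in eq
  ... | yes refl | _     = trans (sym eq) (EdgeSet.irrefl G i)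
  ... | no _     | true  = refl
  ... | no _     | false = refl

complete : ∀ {n} (G : Graph n) → size (K n ∖ G) ≤ 0 → G ≅ K n
complete {n} G none = Perm.id , same
  where
  adjacent : ∀ {i j} → i ≢ j → Adj G i j
  adjacent {i} {j} i≢j with adj? G i j
  ... | yes e = e
  ... | no ¬e = contradiction (edgeList⁺ (K n ∖ G) (K∖⁺ G i≢j ¬e)) (unjoined none)
    where
    unjoined : ∀ {L : List (Fin n × Fin n)} {i j} → length L ≤ 0 → ¬ Joined L i j
    unjoined {[]} _ (inj₁ ())
    unjoined {[]} _ (inj₂ ())
  same : ∀ i j → edge G i j ≡ not ⌊ i ≟ j ⌋
  same i j with i ≟ j
  ... | yes refl = EdgeSet.irrefl G i
  ... | no i≢j with edge G i j | adjacent i≢j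
  ... | true | _ = refl

missing-K : ∀ {n} {G : Graph n} → G ≅ K n → ∀ {i j} → i ≢ j → ¬ Adj G i j → Joined [] i j
missing-K (π , iso) {i} {j} i≢j ¬e with (π ⟨$⟩ʳ i) ≟ (π ⟨$⟩ʳ j) | iso i j
... | yes eq | _ = contradiction (trans (sym (Perm.inverseˡ π)) (trans (cong (π ⟨$⟩ˡ_) eq) (Perm.inverseˡ π))) i≢j
... | no _   | eq = contradiction (subst T (sym eq) _) ¬e

-- The edges of `M`, pulled back along the isomorphism, contain all non-edges of `G`. By definition
-- `size M` is the length of `edgeList M`.
missing-K∖ : ∀ {n} {G M : Graph n} → G ≅ K n ∖ M →
             ∃[ Ms ] (∀ {i j} → i ≢ j → ¬ Adj G i j → Joined Ms i j) × length Ms ≡ size M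
missing-K∖ {n} {G} {M} (π , iso) = map back (edgeList M) , missing , length-map back (edgeList M)
  where
  back : Fin n × Fin n → Fin n × Fin n
  back (i , j) = π ⟨$⟩ˡ i , π ⟨$⟩ˡ j
  listed : ∀ {i j} → (π ⟨$⟩ʳ i , π ⟨$⟩ʳ j) ∈ˡ edgeList M → (i , j) ∈ˡ map back (edgeList M)
  listed e∈ = subst (_∈ˡ _) (cong₂ _,_ (Perm.inverseˡ π) (Perm.inverseˡ π)) (∈-map⁺ back e∈)
  missing : ∀ {i j} → i ≢ j → ¬ Adj G i j → Joined (map back (edgeList M)) i j
  missing {i} {j} i≢j ¬e = [ inj₁ ∘ listed , inj₂ ∘ listed ]′ (edgeList⁺ M
    (decidable-stable (adj? M _ _) λ ¬e′ → ¬e (subst T (sym (iso i j)) (K∖⁺ M π-distinct ¬e′))))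
    where
    π-distinct : π ⟨$⟩ʳ i ≢ π ⟨$⟩ʳ j
    π-distinct eq = i≢j (trans (sym (Perm.inverseˡ π)) (trans (cong (π ⟨$⟩ˡ_) eq) (Perm.inverseˡ π)))

-- `P` is not assumed decidable, so a maximum is obtained only up to double negation. Each larger
-- value satisfying `P` lowers the remaining gap `d`.
¬¬maximum : ∀ {P : ℕ → Set} d {m} → P m → (∀ l → P l → l ≤ m + d) → ¬ ¬ ∃ (IsMaximum P)
¬¬maximum zero    {m} Pm bound none = none (m , Pm , λ l Pl → subst (l ≤_) (ℕ.+-identityʳ m) (bound l Pl))
¬¬maximum (suc d) {m} Pm bound none = none (m , Pm , λ l Pl → ℕ.≮⇒≥ λ m<l →
  ¬¬maximum d Pl (λ l′ Pl′ → ℕ.≤-trans (bound l′ Pl′)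
    (ℕ.≤-trans (ℕ.≤-reflexive (ℕ.+-suc m d)) (ℕ.+-monoˡ-≤ d m<l))) none)

-- From single sets to the generalized connectivity.

module _ {n k c d} {G : Graph n} (2≤k : 2 ≤ k) (k≤n : k ≤ n) (par : Parity k c d) where

  private
    c≤n : c ≤ n
    c≤n = ℕ.≤-trans (c≤k par) k≤n
      where
      c≤k : ∀ {k c d} → Parity k c d → c ≤ k
      c≤k (even h) = ℕ.m≤m+n h h
      c≤k (odd h)  = s≤s (ℕ.m≤m+n h h)

    d<k : d < k
    d<k = lemma par 2≤k
      where
      lemma : ∀ {k c d} → Parity k c d → 2 ≤ k → d < k
      lemma (even h) 2≤k = ℕ.<⇒≤ 2≤k
      lemma (odd h)  _   = s≤s (ℕ.m≤m+n h h)

    familySize≤∸ : ∀ {S l} → ∣ S ∣ ≡ k → DisjointTrees G S l → l ≤ n ∸ c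
    familySize≤∸ {l = l} S-size family = ℕ.m+n≤o⇒m≤o∸n l (familySize≤ 2≤k par S-size family)

  -- Every set of size `k` admits n - c trees and no more, so any of them attains the minimum.
  sparse⇒Isκₖ : (Ms : List (Fin n × Fin n)) → (∀ {i j} → i ≢ j → ¬ Adj G i j → Joined Ms i j) →
                length Ms ≤ d → Isκₖ k G (n ∸ c)
  sparse⇒Isκₖ Ms missing Ms≤d =
    (let S , _ , S-size = containing [] k z≤n k≤n in S , S-size , packed S-size , λ l → familySize≤∸ S-size) ,
    λ l (S , S-size , _ , maximum) → maximum (n ∸ c) (packed S-size)
    where
    packed : ∀ {S} → ∣ S ∣ ≡ k → DisjointTrees G S (n ∸ c)
    packed S-size = familyExists 2≤k k≤n par S-size Ms missing Ms≤d

  -- If more than `d` edges were missing, one end of each of d + 1 of them would fit into a set `S`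
  -- of size `k`, as d < k. The n - c trees on `S` then contradict `missing≤`.
  Isκₖ⇒sparse : Isκₖ k G (n ∸ c) → size (K n ∖ G) ≤ d
  Isκₖ⇒sparse (_ , minimum) = decidable-stable (size (K n ∖ G) ≤? d) λ many → excess (ℕ.≰⇒> many)
    where
    excess : d < size (K n ∖ G) → ⊥
    -- The search for the maximum starts from the empty family; double negation suffices because the
    -- goal is a contradiction.
    excess d<size = ¬¬maximum (n ∸ c) none (λ l → familySize≤∸ S-size) λ (m , maximal) →
      short (proj₁ maximal) (minimum m (S , S-size , maximal))
      where
      L : List (Fin n × Fin n)
      L = take (suc d) (edgeList (K n ∖ G))
      L-length : length L ≡ suc d
      L-length = trans (length-take (suc d) (edgeList (K n ∖ G))) (ℕ.m≤n⇒m⊓n≡m d<size)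
      L⊆ : ∀ {e} → e ∈ˡ L → e ∈ˡ edgeList (K n ∖ G)
      L⊆ = take-⊆ (suc d) _
        where
        take-⊆ : ∀ {A : Set} m (xs : List A) {e} → e ∈ˡ take m xs → e ∈ˡ xs
        take-⊆ (suc m) (x ∷ xs) (here eq) = here eq
        take-⊆ (suc m) (x ∷ xs) (there e∈) = there (take-⊆ m xs e∈)
      chosen : ∃[ S ] (∀ {i} → i ∈ˡ map proj₁ L → i ∈ S) × ∣ S ∣ ≡ k
      chosen = containing (map proj₁ L) k
        (ℕ.≤-trans (ℕ.≤-reflexive (trans (length-map proj₁ L) L-length)) d<k) k≤n
      S : Subset n
      S = proj₁ chosen
      S-size : ∣ S ∣ ≡ k
      S-size = proj₂ (proj₂ chosen)
      none : DisjointTrees G S 0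
      none = (λ ()) , λ ()
      short : ∀ {m} → DisjointTrees G S m → n ∸ c ≤ m → ⊥
      short {m} family n∸c≤m = ℕ.1+n≰n (subst (_≤ d) L-length
        (missing≤ 2≤k par S-size family
          -- The general upper bound and the minimality of n - c force m + c = n.
          (ℕ.≤-antisym (familySize≤ 2≤k par S-size family)
            (ℕ.≤-trans (ℕ.≤-reflexive (sym (ℕ.m∸n+n≡m c≤n))) (ℕ.+-monoˡ-≤ c n∸c≤m)))
          (Uniqueₚ.take⁺ (suc d) (edgeList-unique (K n ∖ G)))
          λ e∈ → let i<j , e = edgeList⁻ (K n ∖ G) (L⊆ e∈) in
            proj₁ (proj₂ chosen) (∈-map⁺ proj₁ e∈) , i<j , proj₂ (K∖⁻ G e)))

Extremal : ∀ n k → Graph n → Set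
Extremal n k G =
  (2 ∣ k → G ≅ K n) ×
  (¬ (2 ∣ k) → ∃ λ (M : EdgeSet n) → size M ≤ ⌊ k ∸ 1 /2⌋ × G ≅ K n ∖ M)

sparse⇒extremal : ∀ {n k c d} (G : Graph n) → Parity k c d → size (K n ∖ G) ≤ d → Extremal n k G
sparse⇒extremal G (even h) le = (λ _ → complete G le) , λ 2∤ → contradiction (2∣h+h h) 2∤
sparse⇒extremal G (odd h)  le =
  (λ 2∣ → contradiction 2∣ (2∤1+h+h h)) ,
  λ _ → K _ ∖ G , subst (size (K _ ∖ G) ≤_) (ℕ.n≡⌊n+n/2⌋ h) le , K∖K∖ G

extremal⇒Isκₖ : ∀ {n k c d} {G : Graph n} → 2 ≤ k → k ≤ n → Parity k c d → Extremal n k G → Isκₖ k G (n ∸ c)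
extremal⇒Isκₖ {G = G} 2≤k k≤n par@(even h) (G≅K , _) =
  sparse⇒Isκₖ 2≤k k≤n par [] (missing-K {G = G} (G≅K (2∣h+h h))) z≤n
extremal⇒Isκₖ {G = G} 2≤k k≤n par@(odd h) (_ , G≅K∖)
  with M , M≤ , G≅ ← G≅K∖ (2∤1+h+h h)
  with Ms , missing , Ms-length ← missing-K∖ {G = G} {M} G≅
  = sparse⇒Isκₖ 2≤k k≤n par Ms missing
      (ℕ.≤-trans (ℕ.≤-reflexive Ms-length) (subst (size M ≤_) (sym (ℕ.n≡⌊n+n/2⌋ h)) M≤))

theorem4 : ∀ (n k : ℕ) (G : Graph n) → Connected G → 3 ≤ k → k ≤ n →
    Isκₖ k G (n ∸ ⌈ k /2⌉) ⇔
    ((2 ∣ k → G ≅ K n) ×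
    (¬ (2 ∣ k) → ∃ λ (M : EdgeSet n) → size M ≤ ⌊ k ∸ 1 /2⌋ × G ≅ K n ∖ M))
theorem4 n k G _ 3≤k k≤n =
  let c , d , par = parity k in
  subst (λ c → Isκₖ k G (n ∸ c) ⇔ Extremal n k G) (parity-⌈/2⌉ par)
    (mk⇔ (λ κ → sparse⇒extremal G par (Isκₖ⇒sparse 2≤k k≤n par κ)) (extremal⇒Isκₖ 2≤k k≤n par))
  where
  2≤k : 2 ≤ k
  2≤k = ℕ.<⇒≤ 3≤k
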